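{- Let $m>n$ be coprime positive integers with $m\not\equiv n \pmod 2$, such that $4\mid m$ and $8\nmid m$. If $(x,y,z)$ are positive integers with $$(m^2-n^2)^x+(2mn)^y=(m^2+n^2)^z,$$ then either $y=1$ or $x\equiv y\equiv z\equiv 0\pmod 2$. -}

module Defs where

module Submission where

-- Write m = 4k with k, n odd, and a = m² − n², b = 2mn, c = m² + n². Let
-- aˣ + bʸ = cᶻ with y ≥ 2. Modulo 8, x is even.
--
-- If n ≡ ±3 (mod 8), then z is even modulo 16. Suppose y is odd. Write
-- x = 2ᶠX, z = 2ᶠZ with X, Z not both even. If just one of X, Z is odd, then the
-- power of 2 in cᶻ − aˣ forces f ≥ 3y − 3, so that cᶻ − aˣ exceeds bʸ. If both
-- are odd, then c^Z − a^X = 2S with S ≡ 1 (mod 8), and S, being coprime to its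
-- cofactor in bʸ, is a y-th power. Every divisor of S dividing m, and every
-- divisor of the cofactor dividing n, divides some u⁴ + v⁴ and so is ≡ 1
-- (mod 8). Hence n ≡ 1 (mod 8), a contradiction.
--
-- If n ≡ ±1 (mod 8), then (2/(m−n)) = −1 gives y ≡ z (mod 2). Odd y and z
-- are excluded modulo m + n when n ≡ 7 (mod 8), and modulo 32 when
-- n ≡ 1 (mod 16). For n ≡ 9 (mod 16) the conic cU² = A² + bB² has the points
-- (U, A, B) = (1, m−n, 1) and (c^((z−1)/2), (−a)^(x/2), b^((y−1)/2)). Their
-- bilinear form induces factorisations of k and n along which (n/k) and (k/n)
-- can be evaluated, and quadratic reciprocity fails.

open import Defs
import Algebra.Properties.CommutativeMonoid.Sum as Sum
import Algebra.Properties.CommutativeSemigroup as CommutativeSemigroup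
open import Data.Empty using (⊥; ⊥-elim)
open import Data.Fin using (Fin; toℕ; fromℕ<)
import Data.Fin.Properties as Fin
open import Data.Fin.Permutation using (Permutation; permutation)
open import Data.Integer as ℤ using (ℤ; +_; -[1+_]; 0ℤ; 1ℤ; -1ℤ; _+_; _*_; _-_; -_; _^_; _<_; _≤_; +<+; +≤+)
import Data.Integer.DivMod as ℤ
import Data.Integer.Properties as ℤ
open import Data.Integer.Divisibility.Signed using (_∣_; _∣?_; divides; ∣⇒∣ᵤ; ∣ᵤ⇒∣; ∣-refl; ∣-trans; ∣m∣n⇒∣m+n; ∣n⇒∣m*n; ∣m⇒∣m*n)
open import Data.Integer.Tactic.RingSolver using (solve-∀; solve)
open import Data.List using (_∷_; [])
open import Data.Nat as ℕ using (ℕ; zero; suc; z≤n; s≤s)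
import Data.Nat.Coprimality as ℕ
import Data.Nat.DivMod as ℕ
import Data.Nat.Divisibility as ℕ
import Data.Nat.GCD as ℕ
import Data.Nat.Properties as ℕ
import Data.Nat.Tactic.RingSolver as ℕSolver
open import Data.Product using (_×_; _,_; proj₁; proj₂; ∃-syntax)
open import Data.Sign as Sign using (Sign; opposite)
import Data.Sign.Properties as Sign
open import Data.Sum using (_⊎_; inj₁; inj₂; [_,_]′)
open import Relation.Binary.PropositionalEquality
open import Relation.Nullary using (¬_; contradiction; yes; no)
open import Relation.Nullary.Decidable using (from-no)

-- No integer is ever factored into primes. Coprimality is a Bézout identity, roots and splittings
-- come from gcds, and the Jacobi symbol is defined for all odd moduli at once, so local conditions
-- are imposed on arbitrary odd divisors.
--
-- The hard case is n ≡ 9 (mod 16). There n² ≡ 17 (mod 32), hence c ≡ 1, and the congruence that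
-- settles n ≡ 1 (mod 16) says nothing. The conic alone is no obstruction either: c = (m - n)² + b
-- puts a rational point on it. What turns out contradictory is the position of the point given by
-- the solution relative to that one. The value L₁ of the bilinear form at the two points is ≡ 4(k -
-- 2) (mod 16), and this yields a factor s of kn with s ≡ k - 2 (mod 4); the residue symbols along
-- kn = st demand s ≡ k (mod 4).

module Prod = Sum Sign.*-commutativeMonoid
open CommutativeSemigroup Sign.*-commutativeSemigroup using (interchange)

-- Congruences

infix 4 _≅_[_]

-- Wrapped in a record so that unification recovers `a`, `b` and `N`; from the bare difference
-- `a - b` it could not.
record _≅_[_] (a b N : ℤ) : Set where
  constructor mod
  field diff : N ∣ a - b

open _≅_[_] public

∣-lin : ∀ {N a b x} p q → N ∣ a → N ∣ b → x ≡ p * a + q * b → N ∣ x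
∣-lin p q N∣a N∣b refl = ∣m∣n⇒∣m+n (∣n⇒∣m*n p N∣a) (∣n⇒∣m*n q N∣b)

∣-mul : ∀ {N a x} p → N ∣ a → x ≡ p * a → N ∣ x
∣-mul p N∣a refl = ∣n⇒∣m*n p N∣a

≅-by : ∀ {a b N} q → a ≡ b + q * N → a ≅ b [ N ]
≅-by {b = b} {N} q refl = mod (divides q (lem b (q * N)))
  where
  lem : ∀ b k → b + k - b ≡ k
  lem = solve-∀

≅-expand : ∀ {a b N} → a ≅ b [ N ] → ∃[ q ] a ≡ b + q * N
≅-expand {a} {b} (mod (divides q eq)) = q , trans (lem a b) (cong (_+_ b) eq)
  where
  lem : ∀ a b → a ≡ b + (a - b)
  lem = solve-∀

≅-reflexive : ∀ {a b N} → a ≡ b → a ≅ b [ N ]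
≅-reflexive {a} {N = N} refl = ≅-by 0ℤ (solve (a ∷ N ∷ []))

≅-refl : ∀ {a N} → a ≅ a [ N ]
≅-refl = ≅-reflexive refl

≅-sym : ∀ {a b N} → a ≅ b [ N ] → b ≅ a [ N ]
≅-sym {a} {b} (mod d) = mod (∣-mul -1ℤ d (solve (a ∷ b ∷ [])))

≅-trans : ∀ {a b c N} → a ≅ b [ N ] → b ≅ c [ N ] → a ≅ c [ N ]
≅-trans {a} {b} {c} (mod d) (mod e) = mod (∣-lin 1ℤ 1ℤ d e (solve (a ∷ b ∷ c ∷ [])))

≅-+ : ∀ {a b c d N} → a ≅ b [ N ] → c ≅ d [ N ] → a + c ≅ b + d [ N ]
≅-+ {a} {b} {c} {d} (mod p) (mod q) = mod (∣-lin 1ℤ 1ℤ p q (solve (a ∷ b ∷ c ∷ d ∷ [])))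

≅-- : ∀ {a b c d N} → a ≅ b [ N ] → c ≅ d [ N ] → a - c ≅ b - d [ N ]
≅-- {a} {b} {c} {d} (mod p) (mod q) = mod (∣-lin 1ℤ -1ℤ p q (solve (a ∷ b ∷ c ∷ d ∷ [])))

≅-* : ∀ {a b c d N} → a ≅ b [ N ] → c ≅ d [ N ] → a * c ≅ b * d [ N ]
≅-* {a} {b} {c} {d} (mod p) (mod q) = mod (∣-lin c b p q (solve (a ∷ b ∷ c ∷ d ∷ [])))

≅-^ : ∀ {a b N} → a ≅ b [ N ] → ∀ j → a ^ j ≅ b ^ j [ N ]
≅-^ e zero    = ≅-refl
≅-^ e (suc j) = ≅-* e (≅-^ e j)

≅-weaken : ∀ {a b N M} → M ∣ N → a ≅ b [ N ] → a ≅ b [ M ]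
≅-weaken M∣N (mod d) = mod (∣-trans M∣N d)

≅0⇒∣ : ∀ {a N} → a ≅ 0ℤ [ N ] → N ∣ a
≅0⇒∣ {a} (mod d) = ∣-mul 1ℤ d (solve (a ∷ []))

∣⇒≅0 : ∀ {a N} → N ∣ a → a ≅ 0ℤ [ N ]
∣⇒≅0 {a} d = mod (∣-mul 1ℤ d (solve (a ∷ [])))

∣-resp-≅ : ∀ {a b N} → a ≅ b [ N ] → N ∣ a → N ∣ b
∣-resp-≅ e d = ≅0⇒∣ (≅-trans (≅-sym e) (∣⇒≅0 d))

-- Bézout coprimality

record Cop (a b : ℤ) : Set where
  constructor cop
  field
    u v    : ℤ
    bézout : u * a + v * b ≡ 1ℤ

cop-sym : ∀ {a b} → Cop a b → Cop b a
cop-sym {a} {b} (cop u v e) = cop v u (trans (ℤ.+-comm (v * b) (u * a)) e)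

cop-* : ∀ {a b c} → Cop a c → Cop b c → Cop (a * b) c
cop-* {a} {b} {c} (cop u v e) (cop u′ v′ e′) =
  cop (u * u′) (u * a * v′ + v * u′ * b + v * v′ * c)
    (trans (lem a b c u v u′ v′) (cong₂ _*_ e e′))
  where
  lem : ∀ a b c u v u′ v′ →
    u * u′ * (a * b) + (u * a * v′ + v * u′ * b + v * v′ * c) * c ≡ (u * a + v * c) * (u′ * b + v′ * c)
  lem = solve-∀

cop-1ˡ : ∀ {a} → Cop 1ℤ a
cop-1ˡ {a} = cop 1ℤ 0ℤ (solve (a ∷ []))

cop-^ : ∀ {a b} j → Cop a b → Cop (a ^ j) b
cop-^ zero    c = cop-1ˡ
cop-^ (suc j) c = cop-* c (cop-^ j c)

cop-∣ : ∀ {d a b} → d ∣ a → Cop a b → Cop d b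
cop-∣ {d} {b = b} (divides q refl) (cop u v e) = cop (u * q) v (trans (cong (_+ v * b) (ℤ.*-assoc u q d)) e)

cop-∣₂ : ∀ {d e a b} → d ∣ a → e ∣ b → Cop a b → Cop d e
cop-∣₂ d∣a e∣b c = cop-sym (cop-∣ e∣b (cop-sym (cop-∣ d∣a c)))

cop-≅ : ∀ {a b N} → a ≅ b [ N ] → Cop b N → Cop a N
cop-≅ {a} {b} {N} a≅b (cop u v e) with ≅-expand a≅b
... | q , refl = cop u (v - u * q) (trans (lem b N u v q) e)
  where
  lem : ∀ b N u v q → u * (b + q * N) + (v - u * q) * N ≡ u * b + v * N
  lem = solve-∀

cop-∣-* : ∀ {a b c} → Cop a b → a ∣ b * c → a ∣ c
cop-∣-* {a} {b} {c} (cop u v e) d = ∣-lin (u * c) v (∣-refl {a}) d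
  (trans (trans (sym (ℤ.*-identityˡ c)) (cong (_* c) (sym e))) (lem a b c u v))
  where
  lem : ∀ a b c u v → (u * a + v * b) * c ≡ u * c * a + v * (b * c)
  lem = solve-∀

cop-neg : ∀ {a b} → Cop a b → Cop (- a) b
cop-neg {a} {b} (cop u v e) = cop (- u) v (trans (lem a b u v) e)
  where
  lem : ∀ a b u v → - u * - a + v * b ≡ u * a + v * b
  lem = solve-∀

-- Positivity and greatest common divisors

Pos : ℤ → Set
Pos a = 0ℤ < a

pos-* : ∀ {a b} → Pos a → Pos b → Pos (a * b)
pos-* {+ suc a} {+ suc b} _ _ = +<+ (s≤s z≤n)
pos-* {+ 0} (+<+ ())
pos-* {+ suc a} {+ 0} _ (+<+ ())

pos-*-cancelˡ : ∀ {a b} → Pos a → Pos (a * b) → Pos b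
pos-*-cancelˡ {+ 0} (+<+ ())
pos-*-cancelˡ {+ suc a} {+ 0} _ p = contradiction (subst Pos (ℤ.*-zeroʳ (+ suc a)) p) λ { (+<+ ()) }
pos-*-cancelˡ {+ suc a} {+ suc b} _ _ = +<+ (s≤s z≤n)
pos-*-cancelˡ {+ suc a} { -[1+ b ]} _ ()

pos-+ : ∀ {a b} → Pos a → Pos b → Pos (a + b)
pos-+ = ℤ.+-mono-<

pos-^ : ∀ {a} → Pos a → ∀ j → Pos (a ^ j)
pos-^ p zero    = +<+ (s≤s z≤n)
pos-^ p (suc j) = pos-* p (pos-^ p j)

pos-nonZero : ∀ {a} → Pos a → ℤ.NonZero a
pos-nonZero {+ suc a} _ = _
pos-nonZero {+ 0} (+<+ ())

*-cancelˡ : ∀ {a b} c → Pos c → c * a ≡ c * b → a ≡ b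
*-cancelˡ {a} {b} c p = ℤ.*-cancelˡ-≡ c a b {{pos-nonZero p}}

∣-antisym : ∀ {a b} → Pos a → Pos b → a ∣ b → b ∣ a → a ≡ b
∣-antisym {+ suc a} {+ suc b} _ _ d e = cong +_ (ℕ.∣-antisym (∣⇒∣ᵤ d) (∣⇒∣ᵤ e))
∣-antisym {+ 0} (+<+ ())
∣-antisym {+ suc a} {+ 0} _ (+<+ ())

coprime⇒cop : ∀ {a b} → ℕ.Coprime a b → Cop (+ a) (+ b)
coprime⇒cop {a} {b} c with ℕ.coprime-Bézout c
... | ℕ.Bézout.+- x y eq = cop (+ x) (- (+ y)) (begin
  + x * + a + - (+ y) * + b      ≡⟨ cong₂ _+_ (sym (ℤ.pos-* x a)) (trans (sym (ℤ.neg-distribˡ-* (+ y) (+ b))) (cong -_ (sym (ℤ.pos-* y b)))) ⟩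
  + (x ℕ.* a) - + (y ℕ.* b)      ≡⟨ cong (λ t → + t - + (y ℕ.* b)) (sym eq) ⟩
  1ℤ + + (y ℕ.* b) - + (y ℕ.* b) ≡⟨ lem (+ (y ℕ.* b)) ⟩
  1ℤ ∎)
  where
  open ≡-Reasoning
  lem : ∀ t → 1ℤ + t - t ≡ 1ℤ
  lem = solve-∀
... | ℕ.Bézout.-+ x y eq = cop (- (+ x)) (+ y) (begin
  - (+ x) * + a + + y * + b      ≡⟨ cong₂ _+_ (trans (sym (ℤ.neg-distribˡ-* (+ x) (+ a))) (cong -_ (sym (ℤ.pos-* x a)))) (sym (ℤ.pos-* y b)) ⟩
  - (+ (x ℕ.* a)) + + (y ℕ.* b)  ≡⟨ cong (λ t → - (+ (x ℕ.* a)) + + t) (sym eq) ⟩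
  - (+ (x ℕ.* a)) + (1ℤ + + (x ℕ.* a)) ≡⟨ lem (+ (x ℕ.* a)) ⟩
  1ℤ ∎)
  where
  open ≡-Reasoning
  lem : ∀ t → - t + (1ℤ + t) ≡ 1ℤ
  lem = solve-∀

record GCD (a b : ℤ) : Set where
  field
    g a′ b′ : ℤ
    pos     : Pos g
    eqˡ     : a ≡ g * a′
    eqʳ     : b ≡ g * b′
    coprime : Cop a′ b′

-- Only `a` has to be positive: in the conic argument `b` is a difference of unknown sign. The
-- Bézout identity is obtained for ∣b∣ and carried back by the factor `s` with ∣b∣ = s · b.
gcd : ∀ a b → Pos a → GCD a b
gcd (+ 0) _ (+<+ ())
gcd a@(+ suc i) b pa = result (ℕ.gcd-GCD (suc i) ℤ.∣ b ∣)
  where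
  bézout : ∀ {g} → ℕ.GCD (suc i) ℤ.∣ b ∣ g → ∃[ u ] ∃[ v ] u * a + v * (+ ℤ.∣ b ∣) ≡ + g
  bézout {g} G with ℕ.Bézout.identity G
  ... | ℕ.Bézout.+- x y eq = + x , - (+ y) , (begin
    + x * a + - (+ y) * + ℤ.∣ b ∣      ≡⟨ cong₂ _+_ (sym (ℤ.pos-* x (suc i))) (trans (sym (ℤ.neg-distribˡ-* (+ y) (+ ℤ.∣ b ∣))) (cong -_ (sym (ℤ.pos-* y ℤ.∣ b ∣)))) ⟩
    + (x ℕ.* suc i) - + (y ℕ.* ℤ.∣ b ∣)      ≡⟨ cong (λ t → + t - + (y ℕ.* ℤ.∣ b ∣)) (sym eq) ⟩
    + g + + (y ℕ.* ℤ.∣ b ∣) - + (y ℕ.* ℤ.∣ b ∣) ≡⟨ lem (+ g) (+ (y ℕ.* ℤ.∣ b ∣)) ⟩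
    + g ∎)
    where
    open ≡-Reasoning
    lem : ∀ g t → g + t - t ≡ g
    lem = solve-∀
  ... | ℕ.Bézout.-+ x y eq = - (+ x) , + y , (begin
    - (+ x) * a + + y * + ℤ.∣ b ∣      ≡⟨ cong₂ _+_ (trans (sym (ℤ.neg-distribˡ-* (+ x) a)) (cong -_ (sym (ℤ.pos-* x (suc i))))) (sym (ℤ.pos-* y ℤ.∣ b ∣)) ⟩
    - (+ (x ℕ.* suc i)) + + (y ℕ.* ℤ.∣ b ∣)  ≡⟨ cong (λ t → - (+ (x ℕ.* suc i)) + + t) (sym eq) ⟩
    - (+ (x ℕ.* suc i)) + (+ g + + (x ℕ.* suc i)) ≡⟨ lem (+ g) (+ (x ℕ.* suc i)) ⟩
    + g ∎)
    where
    open ≡-Reasoning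
    lem : ∀ g t → - t + (g + t) ≡ g
    lem = solve-∀

  result : ∀ {g} → ℕ.GCD (suc i) ℤ.∣ b ∣ g → GCD a b
  result {zero} G = contradiction (ℕ.0∣⇒≡0 (proj₁ (ℕ.GCD.commonDivisor G))) λ ()
  result {g@(suc _)} G
    with ∣ᵤ⇒∣ {+ g} {a} (proj₁ (ℕ.GCD.commonDivisor G)) | ∣ᵤ⇒∣ {+ g} {b} (proj₂ (ℕ.GCD.commonDivisor G))
       | bézout G | ∣ᵤ⇒∣ {b} {+ ℤ.∣ b ∣} ℕ.∣-refl
  ... | divides a′ ea | divides b′ eb | u , v , euv | divides s es = record
    { g = + g ; a′ = a′ ; b′ = b′ ; pos = +<+ (s≤s z≤n)
    ; eqˡ = trans ea (ℤ.*-comm a′ (+ g)) ; eqʳ = trans eb (ℤ.*-comm b′ (+ g))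
    ; coprime = cop u (v * s) (ℤ.*-cancelʳ-≡ _ 1ℤ (+ g) (begin
        (u * a′ + v * s * b′) * + g         ≡⟨ lem u a′ v s b′ (+ g) ⟩
        u * (a′ * + g) + v * (s * (b′ * + g)) ≡⟨ cong₂ (λ p q → u * p + v * (s * q)) (sym ea) (sym eb) ⟩
        u * a + v * (s * b)                 ≡⟨ cong (λ t → u * a + v * t) (sym es) ⟩
        u * a + v * + ℤ.∣ b ∣                 ≡⟨ euv ⟩
        + g                                 ≡⟨ sym (ℤ.*-identityˡ (+ g)) ⟩
        1ℤ * + g ∎)) }
    where
    open ≡-Reasoning
    lem : ∀ u a v s b g → (u * a + v * s * b) * g ≡ u * (a * g) + v * (s * (b * g))
    lem = solve-∀

-- A positive odd modulus is given by its half h, the length of the half system 1, ..., h. Opacity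
-- keeps `odd h` from unfolding, so that `h` can be read off from it.
opaque
  odd : ℕ → ℤ
  odd h = + suc (2 ℕ.* h)

  odd≡ : ∀ h → odd h ≡ + suc (2 ℕ.* h)
  odd≡ h = refl

odd-def : ∀ h → odd h ≡ 1ℤ + + 2 * + h
odd-def h = trans (odd≡ h) (cong (_+_ 1ℤ) (ℤ.pos-* 2 h))

infix 8 ⟪_⟫

⟪_⟫ : Sign → ℤ
⟪ Sign.+ ⟫ = 1ℤ
⟪ Sign.- ⟫ = -1ℤ

⟪⟫-* : ∀ s t → ⟪ s Sign.* t ⟫ ≡ ⟪ s ⟫ * ⟪ t ⟫
⟪⟫-* Sign.+ t = sym (ℤ.*-identityˡ ⟪ t ⟫)
⟪⟫-* Sign.- Sign.+ = refl
⟪⟫-* Sign.- Sign.- = refl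

-- Least absolute residues modulo 2h + 1

record Residue (h : ℕ) (z : ℤ) : Set where
  constructor residue
  field
    sgn  : Sign
    abs  : ℕ
    abs≤ : abs ℕ.≤ h
    eq   : z ≅ ⟪ sgn ⟫ * + abs [ odd h ]

odd∸-≤ : ∀ h r → suc h ℕ.≤ r → suc (2 ℕ.* h) ℕ.∸ r ℕ.≤ h
odd∸-≤ h r h<r = begin
  suc (2 ℕ.* h) ℕ.∸ r     ≤⟨ ℕ.∸-monoʳ-≤ (suc (2 ℕ.* h)) h<r ⟩
  2 ℕ.* h ℕ.∸ h           ≡⟨ cong (ℕ._∸ h) (cong (h ℕ.+_) (ℕ.+-identityʳ h)) ⟩
  h ℕ.+ h ℕ.∸ h           ≡⟨ ℕ.m+n∸n≡m h h ⟩
  h ∎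
  where open ℕ.≤-Reasoning

pos-∸ : ∀ {m n} → n ℕ.≤ m → + (m ℕ.∸ n) ≡ + m - + n
pos-∸ {m} {n} n≤m = sym (trans (ℤ.m-n≡m⊖n m n) (ℤ.⊖-≥ n≤m))

-- Quotient and remainder are arguments, so that the parity of a remainder from any division can
-- later be compared with the sign (`parity-residueOf`).
residueOf : ∀ h z q r → r ℕ.< suc (2 ℕ.* h) → z ≡ + r + q * odd h → Residue h z
residueOf h z q r r<N eq with r ℕ.≤? h
... | yes r≤h = residue Sign.+ r r≤h (≅-by q (trans eq (cong (_+ q * odd h) (sym (ℤ.*-identityˡ (+ r))))))
... | no  r≰h = residue Sign.- (suc (2 ℕ.* h) ℕ.∸ r) (odd∸-≤ h r (ℕ.≰⇒> r≰h))
  (≅-by (q + 1ℤ) (trans eq (trans (lem (+ r) q (odd h)) (cong (λ t → -1ℤ * t + (q + 1ℤ) * odd h) (trans (cong (_- + r) (odd≡ h)) (sym (pos-∸ (ℕ.<⇒≤ r<N))))))))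
  where
  lem : ∀ r q N → r + q * N ≡ -1ℤ * (N - r) + (q + 1ℤ) * N
  lem = solve-∀

residues : ∀ h z → Residue h z
residues h z = residueOf h z (z ℤ./ℕ N) (z ℤ.%ℕ N) (ℤ.n%ℕd<d z N)
  (trans (ℤ.a≡a%ℕn+[a/ℕn]*n z N) (cong (λ t → + (z ℤ.%ℕ N) + (z ℤ./ℕ N) * t) (sym (odd≡ h))))
  where N = suc (2 ℕ.* h)

≤h⇒<odd : ∀ {w h} → w ℕ.≤ h → w ℕ.< suc (2 ℕ.* h)
≤h⇒<odd {h = h} w≤h = s≤s (ℕ.≤-trans w≤h (ℕ.m≤m+n h _))

∣∧<⇒≡0 : ∀ {h x} → odd h ∣ x → ℤ.∣ x ∣ ℕ.< suc (2 ℕ.* h) → x ≡ 0ℤ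
∣∧<⇒≡0 {h} {x} d lt with ℤ.∣ x ∣ in e
... | zero  = ℤ.∣i∣≡0⇒i≡0 e
... | suc k = contradiction lt (ℕ.≤⇒≯ (ℕ.∣⇒≤ (subst₂ ℕ._∣_ (cong ℤ.∣_∣ (odd≡ h)) e (∣⇒∣ᵤ d))))

private
  ≅-diff : ∀ h {w w′} → w ℕ.≤ h → w′ ℕ.≤ h → odd h ∣ + w - + w′ → w ≡ w′
  ≅-diff h {w} {w′} l l′ d = ℤ.+-injective (ℤ.i-j≡0⇒i≡j (+ w) (+ w′) (∣∧<⇒≡0 d
    (subst (λ t → ℤ.∣ t ∣ ℕ.< _) (sym (ℤ.m-n≡m⊖n w w′))
      (ℕ.≤-<-trans (ℤ.∣m⊝n∣≤m⊔n w w′) (≤h⇒<odd (ℕ.⊔-lub l l′))))))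

  ≅-sum : ∀ h {w w′} → w ℕ.≤ h → suc w′ ℕ.≤ h → ¬ odd h ∣ + w + + suc w′
  ≅-sum h {w} {w′} l l′ d = contradiction (ℤ.+-injective (∣∧<⇒≡0 d
      (s≤s (ℕ.≤-trans (ℕ.+-mono-≤ l l′) (ℕ.≤-reflexive (cong (h ℕ.+_) (sym (ℕ.+-identityʳ h))))))))
    λ e → ℕ.1+n≢0 (trans (sym (ℕ.+-suc w w′)) e)

-- One absolute value is taken nonzero, since 0 carries both signs. The difference or sum of the
-- absolute values is a multiple of 2h + 1 of size at most 2h, hence 0, and a sum with a nonzero
-- term is not 0.
residue-unique : ∀ {h} s t {w w′} → w ℕ.≤ h → suc w′ ℕ.≤ h →
  ⟪ s ⟫ * + w ≅ ⟪ t ⟫ * + suc w′ [ odd h ] → s ≡ t × w ≡ suc w′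
residue-unique {h} Sign.+ Sign.+ {w} {w′} l l′ (mod d) = refl , ≅-diff h l l′ (∣-mul 1ℤ d (lem (+ w) (+ suc w′)))
  where
  lem : ∀ a b → a - b ≡ 1ℤ * (1ℤ * a - 1ℤ * b)
  lem = solve-∀
residue-unique {h} Sign.- Sign.- {w} {w′} l l′ (mod d) = refl , ≅-diff h l l′ (∣-mul -1ℤ d (lem (+ w) (+ suc w′)))
  where
  lem : ∀ a b → a - b ≡ -1ℤ * (-1ℤ * a - -1ℤ * b)
  lem = solve-∀
residue-unique {h} Sign.+ Sign.- {w} {w′} l l′ (mod d) = contradiction (∣-mul 1ℤ d (lem (+ w) (+ suc w′))) (≅-sum h l l′)
  where
  lem : ∀ a b → a + b ≡ 1ℤ * (1ℤ * a - -1ℤ * b)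
  lem = solve-∀
residue-unique {h} Sign.- Sign.+ {w} {w′} l l′ (mod d) = contradiction (∣-mul -1ℤ d (lem (+ w) (+ suc w′))) (≅-sum h l l′)
  where
  lem : ∀ a b → a + b ≡ -1ℤ * (-1ℤ * a - 1ℤ * b)
  lem = solve-∀

-- The Jacobi symbol (a / 2h + 1), defined by the Gauss–Schering lemma

val : ∀ {h} → Fin h → ℤ
val j = + suc (toℕ j)

ε : ∀ h → ℤ → Fin h → Sign
ε h a j = Residue.sgn (residues h (a * val j))

-- The value is a sign, never 0. It is meaningful for `a` coprime to 2h + 1; otherwise some multiple
-- has residue 0, whose sign is a convention.
jacobi : ℤ → ℕ → Sign
jacobi a h = Prod.sum (ε h a)

ε-unique : ∀ {h} a (j j′ : Fin h) s → a * val j ≅ ⟪ s ⟫ * val j′ [ odd h ] → ε h a j ≡ s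
ε-unique {h} a j j′ s e with residues h (a * val j)
... | residue t w w≤h eq = proj₁ (residue-unique t s w≤h (Fin.toℕ<n j′) (≅-trans (≅-sym eq) e))

val-unique : ∀ {h} (j j′ : Fin h) s → val j ≅ ⟪ s ⟫ * val j′ [ odd h ] → j ≡ j′
val-unique j j′ s e = Fin.toℕ-injective (ℕ.suc-injective
  (proj₂ (residue-unique Sign.+ s (Fin.toℕ<n j) (Fin.toℕ<n j′) (≅-trans (≅-reflexive (ℤ.*-identityˡ (val j))) e))))

¬odd∣val : ∀ {h} (j : Fin h) → ¬ odd h ∣ val j
¬odd∣val j d = contradiction (∣∧<⇒≡0 d (≤h⇒<odd (Fin.toℕ<n j))) λ ()

-- A unit permutes the classes ±1, ..., ±h of all nonzero residues, also for composite 2h + 1: av ≡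
-- 0 would force v ≡ 0. The signs met on the way are the `ε`.
π : ∀ {h a} → Cop a (odd h) → Fin h → Fin h
π-spec : ∀ {h a} (c : Cop a (odd h)) j → a * val j ≅ ⟪ ε h a j ⟫ * val (π c j) [ odd h ]

private
  step : ∀ {h a} → Cop a (odd h) → (j : Fin h) → ∃[ j′ ] a * val j ≅ ⟪ ε h a j ⟫ * val j′ [ odd h ]
  step {h} {a} c j with residues h (a * val j)
  ... | residue s zero w≤h eq = contradiction
    (cop-∣-* (cop-sym c) (≅0⇒∣ (≅-trans eq (≅-reflexive (ℤ.*-zeroʳ ⟪ s ⟫))))) (¬odd∣val j)
  ... | residue s (suc w) w<h eq = fromℕ< w<h ,
    ≅-trans eq (≅-reflexive (cong (λ t → ⟪ s ⟫ * + suc t) (sym (Fin.toℕ-fromℕ< w<h))))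

π c j = proj₁ (step c j)
π-spec c j = proj₂ (step c j)

π-inverse : ∀ {h a b} (c : Cop a (odd h)) (d : Cop b (odd h)) → b * a ≅ 1ℤ [ odd h ] → ∀ j → π d (π c j) ≡ j
π-inverse {h} {a} {b} c d ba≅1 j = sym (val-unique j (π d (π c j)) (s Sign.* t)
  (≅-trans (≅-sym (≅-trans (≅-* ba≅1 ≅-refl) (≅-reflexive (ℤ.*-identityˡ (val j)))))
  (≅-trans (≅-reflexive (ℤ.*-assoc b a (val j)))
  (≅-trans (≅-* (≅-refl {b}) (π-spec c j))
  (≅-trans (≅-reflexive (lem b ⟪ s ⟫ (val (π c j))))
  (≅-trans (≅-* (≅-refl {⟪ s ⟫}) (π-spec d (π c j)))
  (≅-reflexive (trans (sym (ℤ.*-assoc ⟪ s ⟫ ⟪ t ⟫ _)) (cong (_* val (π d (π c j))) (sym (⟪⟫-* s t)))))))))))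
  where
  s = ε h a j
  t = ε h b (π c j)
  lem : ∀ b s v → b * (s * v) ≡ s * (b * v)
  lem = solve-∀

inverse : ∀ {a N} → Cop a N → ∃[ u ] Cop u N × u * a ≅ 1ℤ [ N ]
inverse {a} {N} (cop u v e) = u , cop a v (trans (cong (_+ v * N) (ℤ.*-comm a u)) e) ,
  ≅-by (- v) (trans (lem (u * a) v N) (cong (_+ - v * N) e))
  where
  lem : ∀ x v N → x ≡ x + v * N + - v * N
  lem = solve-∀

π-perm : ∀ {h a} → Cop a (odd h) → Permutation h h
π-perm {h} {a} c with inverse c
... | u , d , ua≅1 = permutation (π c) (π d)
  (π-inverse d c (≅-trans (≅-reflexive (ℤ.*-comm a u)) ua≅1)) (π-inverse c d ua≅1)

∏-π : ∀ {h a} (c : Cop a (odd h)) f → Prod.sum (λ j → f (π c j)) ≡ Prod.sum f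
∏-π c f = sym (Prod.sum-permute f (π-perm c))

jacobi-cong : ∀ {a b h} → Cop a (odd h) → a ≅ b [ odd h ] → jacobi b h ≡ jacobi a h
jacobi-cong {a} {b} {h} c a≅b = Prod.sum-cong-≗ {h} λ j →
  ε-unique b j (π c j) (ε h a j) (≅-trans (≅-* (≅-sym a≅b) ≅-refl) (π-spec c j))

-- The sign of abj is that of aj times that of b · π(j); reindexing by the permutation π turns the
-- second product into the symbol of b.
jacobi-* : ∀ {a b h} → Cop a (odd h) → Cop b (odd h) → jacobi (a * b) h ≡ jacobi a h Sign.* jacobi b h
jacobi-* {a} {b} {h} c d = trans (Prod.sum-cong-≗ {h} pointwise)
  (trans (Prod.∑-distrib-+ {h} (ε h a) (λ j → ε h b (π c j))) (cong (jacobi a h Sign.*_) (∏-π c (ε h b))))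
  where
  lem : ∀ a b v → a * b * v ≡ b * (a * v)
  lem = solve-∀
  lem′ : ∀ b s v → b * (s * v) ≡ s * (b * v)
  lem′ = solve-∀
  pointwise : ∀ j → ε h (a * b) j ≡ ε h a j Sign.* ε h b (π c j)
  pointwise j = ε-unique (a * b) j (π d (π c j)) _
    (≅-trans (≅-reflexive (lem a b (val j)))
    (≅-trans (≅-* (≅-refl {b}) (π-spec c j))
    (≅-trans (≅-reflexive (lem′ b ⟪ s ⟫ (val (π c j))))
    (≅-trans (≅-* (≅-refl {⟪ s ⟫}) (π-spec d (π c j)))
    (≅-reflexive (trans (sym (ℤ.*-assoc ⟪ s ⟫ ⟪ t ⟫ _)) (cong (_* val (π d (π c j))) (sym (⟪⟫-* s t)))))))))
    where
    s = ε h a j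
    t = ε h b (π c j)

parity : ℕ → Sign
parity zero    = Sign.+
parity (suc n) = opposite (parity n)

parity-+ : ∀ m n → parity (m ℕ.+ n) ≡ parity m Sign.* parity n
parity-+ zero    n = refl
parity-+ (suc m) n = trans (cong opposite (parity-+ m n)) (lem (parity m) (parity n))
  where
  lem : ∀ s t → opposite (s Sign.* t) ≡ opposite s Sign.* t
  lem Sign.+ t = refl
  lem Sign.- Sign.+ = refl
  lem Sign.- Sign.- = refl

parity-double : ∀ n → parity (2 ℕ.* n) ≡ Sign.+
parity-double n = trans (parity-+ n (n ℕ.+ 0)) (trans (cong (λ t → parity n Sign.* parity t) (ℕ.+-identityʳ n)) (Sign.s*s≡+ (parity n)))

parity-odd* : ∀ h n → parity (suc (2 ℕ.* h) ℕ.* n) ≡ parity n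
parity-odd* h n = trans (parity-+ n (2 ℕ.* h ℕ.* n)) (trans (cong (parity n Sign.*_)
  (trans (cong parity (ℕ.*-assoc 2 h n)) (parity-double (h ℕ.* n)))) (Sign.*-identityʳ (parity n)))

∏-- : ∀ h → Prod.sum {h} (λ _ → Sign.-) ≡ parity h
∏-- zero    = refl
∏-- (suc h) = cong opposite (∏-- h)

∏-+ : ∀ h → Prod.sum {h} (λ _ → Sign.+) ≡ Sign.+
∏-+ = Prod.sum-replicate-zero

jacobi-1 : ∀ h → jacobi 1ℤ h ≡ Sign.+
jacobi-1 h = trans (Prod.sum-cong-≗ {h} λ j → ε-unique 1ℤ j j Sign.+ ≅-refl) (∏-+ h)

jacobi--1 : ∀ h → jacobi -1ℤ h ≡ parity h
jacobi--1 h = trans (Prod.sum-cong-≗ {h} λ j → ε-unique -1ℤ j j Sign.- ≅-refl) (∏-- h)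

jacobi-square : ∀ {a h} → Cop a (odd h) → jacobi (a * a) h ≡ Sign.+
jacobi-square {a} {h} c = trans (jacobi-* {h = h} c c) (Sign.s*s≡+ (jacobi a h))

-- Quadratic reciprocity, by Eisenstein's count of lattice points

χ : ℕ → ℕ → Sign
χ m       zero    = Sign.+
χ zero    (suc n) = Sign.-
χ (suc m) (suc n) = χ m n

χ-< : ∀ {m n} → m ℕ.< n → χ m n ≡ Sign.-
χ-< {zero}  {suc n} _         = refl
χ-< {suc m} {suc n} (s≤s m<n) = χ-< m<n

χ-≥ : ∀ {m n} → n ℕ.≤ m → χ m n ≡ Sign.+
χ-≥ {n = zero}      _         = refl
χ-≥ {suc m} {suc n} (s≤s n≤m) = χ-≥ n≤m

χ-≢ : ∀ {m n} → m ≢ n → χ m n Sign.* χ n m ≡ Sign.-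
χ-≢ {zero}  {zero}  m≢n = contradiction refl m≢n
χ-≢ {zero}  {suc n} m≢n = refl
χ-≢ {suc m} {zero}  m≢n = refl
χ-≢ {suc m} {suc n} m≢n = χ-≢ λ m≡n → m≢n (cong suc m≡n)

∏-χ : ∀ {h q} → q ℕ.≤ h → Prod.sum {h} (λ i → χ (toℕ i) q) ≡ parity q
∏-χ {h}     {zero}  _         = ∏-+ h
∏-χ {suc h} {suc q} (s≤s q≤h) = cong opposite (∏-χ q≤h)

-- As 0 < r < N, the inequality N(i + 1) < qN + r means i + 1 ≤ q. The lattice points in one column
-- are thus counted by the quotient.
χ-quotient : ∀ N q r i → r ℕ.< N → 0 ℕ.< r → χ (N ℕ.* suc i) (q ℕ.* N ℕ.+ r) ≡ χ i q
χ-quotient N q r i r<N 0<r with i ℕ.<? q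
... | yes i<q = trans (χ-< (begin-strict
    N ℕ.* suc i     ≡⟨ ℕ.*-comm N (suc i) ⟩
    suc i ℕ.* N     ≤⟨ ℕ.*-monoˡ-≤ N i<q ⟩
    q ℕ.* N         <⟨ ℕ.m<m+n (q ℕ.* N) 0<r ⟩
    q ℕ.* N ℕ.+ r ∎)) (sym (χ-< i<q))
  where open ℕ.≤-Reasoning
... | no  i≮q = trans (χ-≥ (begin
    q ℕ.* N ℕ.+ r   ≤⟨ ℕ.+-mono-≤ (ℕ.*-monoˡ-≤ N (ℕ.≮⇒≥ i≮q)) (ℕ.<⇒≤ r<N) ⟩
    i ℕ.* N ℕ.+ N   ≡⟨ ℕ.+-comm (i ℕ.* N) N ⟩
    suc i ℕ.* N     ≡⟨ ℕ.*-comm (suc i) N ⟩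
    N ℕ.* suc i ∎)) (sym (χ-≥ (ℕ.≮⇒≥ i≮q)))
  where open ℕ.≤-Reasoning

-- Passing from r to N - r flips the parity, as N is odd, and flips the sign as well.
parity-residueOf : ∀ h {z q r} (r<N : r ℕ.< suc (2 ℕ.* h)) (eq : z ≡ + r + q * odd h) →
  let open Residue (residueOf h z q r r<N eq) in parity r ≡ parity abs Sign.* sgn
parity-residueOf h {r = r} r<N eq with r ℕ.≤? h
... | yes r≤h = sym (Sign.*-identityʳ (parity r))
... | no  r≰h = flip {parity (N ℕ.∸ r)} (trans (sym (parity-+ (N ℕ.∸ r) r)) (trans (cong parity (ℕ.m∸n+n≡m (ℕ.<⇒≤ r<N))) (cong opposite (parity-double h))))
  where
  N = suc (2 ℕ.* h)
  flip : ∀ {s t : Sign} → s Sign.* t ≡ Sign.- → t ≡ s Sign.* Sign.-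
  flip {Sign.+} {Sign.-} _ = refl
  flip {Sign.-} {Sign.+} _ = refl

module Eisenstein (h h′ : ℕ) (c : Cop (odd h′) (odd h)) where

  N a : ℕ
  N = suc (2 ℕ.* h)
  a = suc (2 ℕ.* h′)

  ¬N∣aj : ∀ j → ¬ N ℕ.∣ a ℕ.* suc (toℕ j)
  ¬N∣aj j d = ¬odd∣val j (cop-∣-* (cop-sym c) (subst₂ _∣_ (sym (odd≡ h)) (trans (ℤ.pos-* a (suc (toℕ j))) (cong (_* val j) (sym (odd≡ h′)))) (∣ᵤ⇒∣ d)))

  -- The quotients and remainders are parameters: only the division identity and the bound on the
  -- remainder enter.
  module Quotients (quot rem : Fin h → ℕ) (division : ∀ j → a ℕ.* suc (toℕ j) ≡ quot j ℕ.* N ℕ.+ rem j) (rem<N : ∀ j → rem j ℕ.< N) where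

    rem>0 : ∀ j → 0 ℕ.< rem j
    rem>0 j = ℕ.n≢0⇒n>0 λ e → ¬N∣aj j (subst (N ℕ.∣_) (sym (trans (division j) (trans (cong (quot j ℕ.* N ℕ.+_) e) (ℕ.+-identityʳ _)))) (ℕ.divides (quot j) refl))

    -- From 2qN ≤ 2ah < aN follows 2q < a. Hence the h′ rows of the lattice are enough to count the
    -- whole quotient.
    quot≤ : ∀ j → quot j ℕ.≤ h′
    quot≤ j = ℕ.≮⇒≥ λ h′<q → ℕ.<-irrefl refl (begin-strict
      a ℕ.* h ℕ.+ a ℕ.* h               ≡⟨ lem a h ⟩
      a ℕ.* (2 ℕ.* h)                   <⟨ ℕ.*-monoʳ-< a (ℕ.n<1+n (2 ℕ.* h)) ⟩
      a ℕ.* N                           ≤⟨ ℕ.*-monoˡ-≤ N (ℕ.≤-trans (ℕ.n≤1+n a) (ℕ.≤-trans (ℕ.≤-reflexive (sym (ℕ.*-suc 2 h′))) (ℕ.*-monoʳ-≤ 2 h′<q))) ⟩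
      2 ℕ.* quot j ℕ.* N                ≡⟨ trans (ℕ.*-assoc 2 (quot j) N) (cong (quot j ℕ.* N ℕ.+_) (ℕ.+-identityʳ _)) ⟩
      quot j ℕ.* N ℕ.+ quot j ℕ.* N     ≤⟨ ℕ.+-mono-≤ qN≤ qN≤ ⟩
      a ℕ.* h ℕ.+ a ℕ.* h ∎)
      where
      open ℕ.≤-Reasoning
      lem : ∀ a h → a ℕ.* h ℕ.+ a ℕ.* h ≡ a ℕ.* (2 ℕ.* h)
      lem = ℕSolver.solve-∀
      qN≤ : quot j ℕ.* N ℕ.≤ a ℕ.* h
      qN≤ = ℕ.≤-trans (ℕ.m≤m+n _ (rem j)) (ℕ.≤-trans (ℕ.≤-reflexive (sym (division j))) (ℕ.*-monoʳ-≤ a (Fin.toℕ<n j)))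

    parity-rem : ∀ j → parity (rem j) ≡ parity (suc (toℕ (π c j))) Sign.* ε h (odd h′) j
    parity-rem j = trans (parity-residueOf h (rem<N j) eq) (cong₂ Sign._*_ (cong parity (proj₂ unique)) (proj₁ unique))
      where
      open ≡-Reasoning
      eq : odd h′ * val j ≡ + rem j + + quot j * odd h
      eq = begin
        odd h′ * val j              ≡⟨ cong (_* val j) (odd≡ h′) ⟩
        + a * val j                 ≡⟨ sym (ℤ.pos-* a (suc (toℕ j))) ⟩
        + (a ℕ.* suc (toℕ j))       ≡⟨ cong +_ (trans (division j) (ℕ.+-comm _ (rem j))) ⟩
        + rem j + + (quot j ℕ.* N)  ≡⟨ cong (_+_ (+ rem j)) (ℤ.pos-* (quot j) N) ⟩
        + rem j + + quot j * + N    ≡⟨ cong (λ t → + rem j + + quot j * t) (sym (odd≡ h)) ⟩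
        + rem j + + quot j * odd h ∎
      open Residue (residueOf h (odd h′ * val j) (+ quot j) (rem j) (rem<N j) eq) renaming (eq to abs-eq)
      unique : sgn ≡ ε h (odd h′) j × abs ≡ suc (toℕ (π c j))
      unique = residue-unique sgn (ε h (odd h′) j) abs≤ (Fin.toℕ<n (π c j)) (≅-trans (≅-sym abs-eq) (π-spec c j))

    -- The parity of each remainder has two expressions: it is that of j + q, as aj = qN + r with a
    -- and N odd, and it is that of π(j) corrected by `ε`. In the product over all j the parities of
    -- j and of π(j) cancel, since π is a permutation.
    jacobi-quot : jacobi (odd h′) h ≡ Prod.sum (λ j → parity (quot j))
    jacobi-quot = Sign.*-cancelˡ-≡ P _ _ (begin
      P Sign.* jacobi (odd h′) h
        ≡⟨ cong (Sign._* jacobi (odd h′) h) (sym (∏-π c (λ j → parity (suc (toℕ j))))) ⟩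
      Prod.sum (λ j → parity (suc (toℕ (π c j)))) Sign.* jacobi (odd h′) h
        ≡⟨ sym (Prod.∑-distrib-+ {h} _ _) ⟩
      Prod.sum (λ j → parity (suc (toℕ (π c j))) Sign.* ε h (odd h′) j)
        ≡⟨ Prod.sum-cong-≗ {h} (λ j → sym (parity-rem j)) ⟩
      Prod.sum (λ j → parity (rem j))
        ≡⟨ Prod.sum-cong-≗ {h} parity-rem′ ⟩
      Prod.sum (λ j → parity (suc (toℕ j)) Sign.* parity (quot j))
        ≡⟨ Prod.∑-distrib-+ {h} _ _ ⟩
      P Sign.* Prod.sum (λ j → parity (quot j)) ∎)
      where
      open ≡-Reasoning
      P = Prod.sum {h} (λ j → parity (suc (toℕ j)))
      solve-sign : ∀ {p q r} → p ≡ q Sign.* r → r ≡ p Sign.* q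
      solve-sign {q = Sign.+} {Sign.+} refl = refl
      solve-sign {q = Sign.+} {Sign.-} refl = refl
      solve-sign {q = Sign.-} {Sign.+} refl = refl
      solve-sign {q = Sign.-} {Sign.-} refl = refl
      parity-rem′ : ∀ j → parity (rem j) ≡ parity (suc (toℕ j)) Sign.* parity (quot j)
      parity-rem′ j = solve-sign (begin
        parity (suc (toℕ j))                   ≡⟨ sym (parity-odd* h′ (suc (toℕ j))) ⟩
        parity (a ℕ.* suc (toℕ j))             ≡⟨ cong parity (trans (division j) (cong (ℕ._+ rem j) (ℕ.*-comm (quot j) N))) ⟩
        parity (N ℕ.* quot j ℕ.+ rem j)        ≡⟨ parity-+ (N ℕ.* quot j) (rem j) ⟩
        parity (N ℕ.* quot j) Sign.* parity (rem j) ≡⟨ cong (Sign._* parity (rem j)) (parity-odd* h (quot j)) ⟩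
        parity (quot j) Sign.* parity (rem j) ∎)

    jacobi-lattice : jacobi (odd h′) h ≡ Prod.sum λ (j : Fin h) → Prod.sum λ (i : Fin h′) → χ (N ℕ.* suc (toℕ i)) (a ℕ.* suc (toℕ j))
    jacobi-lattice = trans jacobi-quot (Prod.sum-cong-≗ {h} λ j → sym (trans
      (Prod.sum-cong-≗ {h′} λ i → trans (cong (χ (N ℕ.* suc (toℕ i))) (division j)) (χ-quotient N (quot j) (rem j) (toℕ i) (rem<N j) (rem>0 j)))
      (∏-χ (quot≤ j))))

  open Quotients (λ j → a ℕ.* suc (toℕ j) ℕ./ N) (λ j → a ℕ.* suc (toℕ j) ℕ.% N)
    (λ j → trans (ℕ.m≡m%n+[m/n]*n (a ℕ.* suc (toℕ j)) N) (ℕ.+-comm (a ℕ.* suc (toℕ j) ℕ.% N) (a ℕ.* suc (toℕ j) ℕ./ N ℕ.* N)))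
    (λ j → ℕ.m%n<n (a ℕ.* suc (toℕ j)) N) public using (jacobi-lattice)

∏∏-- : ∀ h h′ → Prod.sum {h} (λ _ → Prod.sum {h′} (λ _ → Sign.-)) ≡ parity (h ℕ.* h′)
∏∏-- zero    h′ = refl
∏∏-- (suc h) h′ = trans (cong₂ Sign._*_ (∏-- h′) (∏∏-- h h′)) (sym (parity-+ h′ (h ℕ.* h′)))

-- The two symbols count the points of one h × h′ rectangle on either side of the line Ni = aj.
-- Coprimality keeps every point off the line, so each contributes exactly one minus sign.
reciprocity : ∀ h h′ → Cop (odd h′) (odd h) → jacobi (odd h′) h Sign.* jacobi (odd h) h′ ≡ parity (h ℕ.* h′)
reciprocity h h′ c = begin
  jacobi (odd h′) h Sign.* jacobi (odd h) h′
    ≡⟨ cong₂ Sign._*_ (Eisenstein.jacobi-lattice h h′ c) (trans (Eisenstein.jacobi-lattice h′ h (cop-sym c)) (Prod.∑-comm {h′} {h} _)) ⟩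
  Prod.sum {h} (λ j → Prod.sum {h′} λ i → χ (N ⊛ i) (a ⊛ j)) Sign.* Prod.sum {h} (λ j → Prod.sum {h′} λ i → χ (a ⊛ j) (N ⊛ i))
    ≡⟨ sym (Prod.∑-distrib-+ {h} _ _) ⟩
  Prod.sum {h} (λ j → Prod.sum {h′} (λ i → χ (N ⊛ i) (a ⊛ j)) Sign.* Prod.sum {h′} (λ i → χ (a ⊛ j) (N ⊛ i)))
    ≡⟨ Prod.sum-cong-≗ {h} (λ j → trans (sym (Prod.∑-distrib-+ {h′} _ _)) (Prod.sum-cong-≗ {h′} λ i → χ-≢ (N⊛i≢a⊛j i j))) ⟩
  Prod.sum {h} (λ _ → Prod.sum {h′} (λ _ → Sign.-))
    ≡⟨ ∏∏-- h h′ ⟩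
  parity (h ℕ.* h′) ∎
  where
  open ≡-Reasoning
  open Eisenstein h h′ c using (N; a; ¬N∣aj)
  infixl 7 _⊛_
  _⊛_ : ∀ {k} → ℕ → Fin k → ℕ
  x ⊛ i = x ℕ.* suc (toℕ i)
  N⊛i≢a⊛j : ∀ (i : Fin h′) (j : Fin h) → N ⊛ i ≢ a ⊛ j
  N⊛i≢a⊛j i j e = ¬N∣aj j (subst (N ℕ.∣_) e (ℕ.m∣m*n (suc (toℕ i))))

-- Supplementary laws, composite moduli, and which moduli make -1 or 2 a square

≇-by : ∀ {a b N} → ¬ (N ∣ a - b) → ¬ (a ≅ b [ N ])
≇-by n (mod d) = n d

odd-suc : ∀ h → odd (suc h) ≡ odd h + + 2
odd-suc h = trans (odd-def (suc h)) (trans (lem (+ h)) (cong (_+ + 2) (sym (odd-def h))))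
  where
  lem : ∀ h → 1ℤ + + 2 * (1ℤ + h) ≡ 1ℤ + + 2 * h + + 2
  lem = solve-∀

odd-+4 : ∀ h → odd (4 ℕ.+ h) ≅ odd h [ + 8 ]
odd-+4 h = ≅-by 1ℤ (trans (odd-def (4 ℕ.+ h)) (trans (lem (+ h)) (cong (_+ + 8) (sym (odd-def h)))))
  where
  lem : ∀ h → 1ℤ + + 2 * (+ 4 + h) ≡ 1ℤ + + 2 * h + + 8
  lem = solve-∀

odd-mod-4 : ∀ h → odd h ≅ ⟪ parity h ⟫ [ + 4 ]
odd-mod-4 zero    = ≅-reflexive (odd≡ 0)
odd-mod-4 (suc h) = ≅-trans (≅-reflexive (odd-suc h)) (≅-trans (≅-+ (odd-mod-4 h) ≅-refl) (lem (parity h)))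
  where
  lem : ∀ s → ⟪ s ⟫ + + 2 ≅ ⟪ opposite s ⟫ [ + 4 ]
  lem Sign.+ = ≅-by 1ℤ refl
  lem Sign.- = ≅-by 0ℤ refl

⟪⟫-injective : ∀ s t → ⟪ s ⟫ ≅ ⟪ t ⟫ [ + 4 ] → s ≡ t
⟪⟫-injective Sign.+ Sign.+ _ = refl
⟪⟫-injective Sign.- Sign.- _ = refl
⟪⟫-injective Sign.+ Sign.- (mod d) = contradiction d (from-no (+ 4 ∣? 1ℤ - -1ℤ))
⟪⟫-injective Sign.- Sign.+ (mod d) = contradiction d (from-no (+ 4 ∣? -1ℤ - 1ℤ))

parity-mod-4 : ∀ h s → odd h ≅ ⟪ s ⟫ [ + 4 ] → parity h ≡ s
parity-mod-4 h s e = ⟪⟫-injective (parity h) s (≅-trans (≅-sym (odd-mod-4 h)) e)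

jacobi-residue : ∀ {a u v} h → Cop a (odd h) → Cop v (odd h) → u * u ≅ a * (v * v) [ odd h ] → jacobi a h ≡ Sign.+
jacobi-residue {a} {u} {v} h ca cv e = begin
  jacobi a h                          ≡⟨ sym (Sign.*-identityʳ (jacobi a h)) ⟩
  jacobi a h Sign.* Sign.+            ≡⟨ cong (jacobi a h Sign.*_) (sym (jacobi-square {h = h} cv)) ⟩
  jacobi a h Sign.* jacobi (v * v) h  ≡⟨ sym (jacobi-* {h = h} ca cvv) ⟩
  jacobi (a * (v * v)) h              ≡⟨ sym (jacobi-cong {h = h} (cop-* ca cvv) (≅-sym e)) ⟩
  jacobi (u * u) h                    ≡⟨ jacobi-square {h = h} (cop-∣ (∣n⇒∣m*n u ∣-refl) (cop-≅ e (cop-* ca cvv))) ⟩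
  Sign.+ ∎
  where
  open ≡-Reasoning
  cvv = cop-* cv cv

-- Positivity is built in: `odd h` runs through the positive odd integers.
Odd : ℤ → Set
Odd N = ∃[ h ] N ≡ odd h

cop-2 : ∀ {N} → Odd N → Cop (+ 2) N
cop-2 (h , refl) = cop (- (+ h)) 1ℤ (trans (cong (λ t → - (+ h) * + 2 + 1ℤ * t) (odd-def h)) (lem (+ h)))
  where
  lem : ∀ h → - h * + 2 + 1ℤ * (1ℤ + + 2 * h) ≡ 1ℤ
  lem = solve-∀

cop--1 : ∀ {N} → Cop -1ℤ N
cop--1 = cop-neg cop-1ˡ

-- -1 ≡ (u/v)² makes the symbol (-1/N) trivial, and for N = 2h + 1 that symbol is (-1)^h.
sum-of-squares : ∀ {N u v} → Odd N → Cop v N → N ∣ u * u + v * v → N ≅ 1ℤ [ + 4 ]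
sum-of-squares {u = u} {v} (h , refl) c d = ≅-trans (odd-mod-4 h) (≅-reflexive (cong ⟪_⟫
  (trans (sym (jacobi--1 h)) (jacobi-residue {u = u} h cop--1 c (mod (∣-mul 1ℤ d (lem u v)))))))
  where
  lem : ∀ u v → u * u - -1ℤ * (v * v) ≡ 1ℤ * (u * u + v * v)
  lem = solve-∀

sign^ : Sign → ℕ → Sign
sign^ s zero    = Sign.+
sign^ s (suc j) = s Sign.* sign^ s j

parity-* : ∀ m n → parity (m ℕ.* n) ≡ sign^ (parity m) n
parity-* m zero    = cong parity (ℕ.*-zeroʳ m)
parity-* m (suc n) = trans (cong parity (ℕ.*-suc m n)) (trans (parity-+ m (m ℕ.* n)) (cong (parity m Sign.*_) (parity-* m n)))

sign^-* : ∀ s t j → sign^ (s Sign.* t) j ≡ sign^ s j Sign.* sign^ t j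
sign^-* s t zero    = refl
sign^-* s t (suc j) = trans (cong (s Sign.* t Sign.*_) (sign^-* s t j)) (interchange s t (sign^ s j) (sign^ t j))

sign^-+ : ∀ j → sign^ Sign.+ j ≡ Sign.+
sign^-+ zero    = refl
sign^-+ (suc j) = sign^-+ j

sign^-- : ∀ j → sign^ Sign.- j ≡ parity j
sign^-- zero    = refl
sign^-- (suc j) = cong opposite (sign^-- j)

*≡+⇒≡ : ∀ s t → s Sign.* t ≡ Sign.+ → s ≡ t
*≡+⇒≡ Sign.+ Sign.+ _ = refl
*≡+⇒≡ Sign.- Sign.- _ = refl

jacobi-flip : ∀ h h′ → Cop (odd h′) (odd h) → parity h ≡ Sign.+ → jacobi (odd h′) h ≡ jacobi (odd h) h′
jacobi-flip h h′ c p = *≡+⇒≡ _ _ (trans (reciprocity h h′ c) (trans (parity-* h h′) (trans (cong (λ s → sign^ s h′) p) (sign^-+ h′))))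

-- The Gauss-Schering definition does not show multiplicativity in the modulus. Reciprocity moves it
-- to the numerator, where it is `jacobi-*`; the reciprocity signs multiply because h ≡ h₁ + h₂ (mod
-- 2).
jacobi-bottom : ∀ α h h₁ h₂ → odd h ≡ odd h₁ * odd h₂ → Cop (odd α) (odd h₁) → Cop (odd α) (odd h₂) →
  jacobi (odd α) h ≡ jacobi (odd α) h₁ Sign.* jacobi (odd α) h₂
jacobi-bottom α h h₁ h₂ eq c₁ c₂ = Sign.*-cancelʳ-≡ (jacobi (odd h) α) _ _ (begin
  jacobi (odd α) h Sign.* jacobi (odd h) α
    ≡⟨ reciprocity h α (subst (Cop (odd α)) (sym eq) (cop-sym (cop-* (cop-sym c₁) (cop-sym c₂)))) ⟩
  parity (h ℕ.* α)
    ≡⟨ trans (parity-* h α) (trans (cong (λ s → sign^ s α) parity-h) (trans (sign^-* (parity h₁) (parity h₂) α)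
         (cong₂ Sign._*_ (sym (parity-* h₁ α)) (sym (parity-* h₂ α))))) ⟩
  parity (h₁ ℕ.* α) Sign.* parity (h₂ ℕ.* α)
    ≡⟨ sym (cong₂ Sign._*_ (reciprocity h₁ α c₁) (reciprocity h₂ α c₂)) ⟩
  (jacobi (odd α) h₁ Sign.* jacobi (odd h₁) α) Sign.* (jacobi (odd α) h₂ Sign.* jacobi (odd h₂) α)
    ≡⟨ interchange (jacobi (odd α) h₁) _ _ _ ⟩
  (jacobi (odd α) h₁ Sign.* jacobi (odd α) h₂) Sign.* (jacobi (odd h₁) α Sign.* jacobi (odd h₂) α)
    ≡⟨ cong (jacobi (odd α) h₁ Sign.* jacobi (odd α) h₂ Sign.*_) (trans (sym (jacobi-* {h = α} (cop-sym c₁) (cop-sym c₂))) (cong (λ t → jacobi t α) (sym eq))) ⟩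
  (jacobi (odd α) h₁ Sign.* jacobi (odd α) h₂) Sign.* jacobi (odd h) α ∎)
  where
  open ≡-Reasoning
  parity-h : parity h ≡ parity h₁ Sign.* parity h₂
  parity-h = parity-mod-4 h _ (≅-trans (≅-reflexive eq) (≅-trans (≅-* (odd-mod-4 h₁) (odd-mod-4 h₂)) (≅-reflexive (sym (⟪⟫-* (parity h₁) (parity h₂))))))

-- Reciprocity between the consecutive odd numbers N and N + 2, where 2 ≡ -N (mod N + 2) and N + 2 ≡
-- 2 (mod N). Its sign is trivial because h(h + 1) is even.
jacobi-2-suc : ∀ h → jacobi (+ 2) (suc h) ≡ parity (suc h) Sign.* jacobi (+ 2) h
jacobi-2-suc h = begin
  jacobi (+ 2) (suc h)
    ≡⟨ sym (jacobi-cong {h = suc h} c2 2≅) ⟩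
  jacobi (-1ℤ * odd h) (suc h)
    ≡⟨ jacobi-* {h = suc h} cop--1 c ⟩
  jacobi -1ℤ (suc h) Sign.* jacobi (odd h) (suc h)
    ≡⟨ cong₂ Sign._*_ (jacobi--1 (suc h)) (*≡+⇒≡ _ _ (trans (reciprocity (suc h) h c) (consecutive h))) ⟩
  parity (suc h) Sign.* jacobi (odd (suc h)) h
    ≡⟨ cong (parity (suc h) Sign.*_) (sym (jacobi-cong {h = h} (cop-≅ ≅2 (cop-2 (h , refl))) ≅2)) ⟩
  parity (suc h) Sign.* jacobi (+ 2) h ∎
  where
  open ≡-Reasoning
  c2 : Cop (+ 2) (odd (suc h))
  c2 = cop-2 (suc h , refl)
  2≅ : + 2 ≅ -1ℤ * odd h [ odd (suc h) ]
  2≅ = ≅-by 1ℤ (trans (lem (odd h)) (cong (λ t → -1ℤ * odd h + 1ℤ * t) (sym (odd-suc h))))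
    where
    lem : ∀ x → + 2 ≡ -1ℤ * x + 1ℤ * (x + + 2)
    lem = solve-∀
  ≅2 : odd (suc h) ≅ + 2 [ odd h ]
  ≅2 = ≅-by 1ℤ (trans (odd-suc h) (lem (odd h)))
    where
    lem : ∀ x → x + + 2 ≡ + 2 + 1ℤ * x
    lem = solve-∀
  c : Cop (odd h) (odd (suc h))
  c = cop-sym (cop-≅ ≅2 (cop-2 (h , refl)))
  consecutive : ∀ h → parity (suc h ℕ.* h) ≡ Sign.+
  consecutive h = trans (parity-+ h (h ℕ.* h)) (trans (cong (parity h Sign.*_) (trans (parity-* h h) (lem (parity h) h refl))) (Sign.s*s≡+ (parity h)))
    where
    lem : ∀ s h → parity h ≡ s → sign^ s h ≡ s
    lem Sign.+ h _ = sign^-+ h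
    lem Sign.- h e = trans (sign^-- h) e

-- (-1)^(h(h+1)/2), which is the classical (-1)^((N²-1)/8) for N = 2h + 1.
triangular : ℕ → Sign
triangular zero    = Sign.+
triangular (suc h) = parity (suc h) Sign.* triangular h

triangular-+4 : ∀ h → triangular (4 ℕ.+ h) ≡ triangular h
triangular-+4 h = lem (parity h) (triangular h)
  where
  lem : ∀ p t → opposite (opposite (opposite (opposite p))) Sign.* (opposite (opposite (opposite p)) Sign.* (opposite (opposite p) Sign.* (opposite p Sign.* t))) ≡ t
  lem Sign.+ Sign.+ = refl
  lem Sign.+ Sign.- = refl
  lem Sign.- Sign.+ = refl
  lem Sign.- Sign.- = refl

triangular-mod-8 : ∀ h → triangular h ≡ Sign.+ → odd h ≅ 1ℤ [ + 8 ] ⊎ odd h ≅ -1ℤ [ + 8 ]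
triangular-mod-8 0 _ = inj₁ (≅-reflexive (odd≡ 0))
triangular-mod-8 3 _ = inj₂ (≅-by 1ℤ (odd≡ 3))
triangular-mod-8 (suc (suc (suc (suc h)))) e with triangular-mod-8 h (trans (sym (triangular-+4 h)) e)
... | inj₁ r = inj₁ (≅-trans (odd-+4 h) r)
... | inj₂ r = inj₂ (≅-trans (odd-+4 h) r)

jacobi-2 : ∀ h → jacobi (+ 2) h ≡ triangular h
jacobi-2 zero    = refl
jacobi-2 (suc h) = trans (jacobi-2-suc h) (cong (parity (suc h) Sign.*_) (jacobi-2 h))

two-is-square : ∀ {N u v} → Odd N → Cop v N → u * u ≅ + 2 * (v * v) [ N ] → N ≅ 1ℤ [ + 8 ] ⊎ N ≅ -1ℤ [ + 8 ]
two-is-square {u = u} {v} (h , refl) c e = triangular-mod-8 h (trans (sym (jacobi-2 h)) (jacobi-residue {u = u} {v} h (cop-2 (h , refl)) c e))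

-- −1 = (u/v)⁴ makes both −1 and 2 = (u/v + v/u)² squares.
sum-of-fourth-powers : ∀ {N u v} → Odd N → Cop v N → N ∣ (u * u) * (u * u) + (v * v) * (v * v) → N ≅ 1ℤ [ + 8 ]
sum-of-fourth-powers {N} {u} {v} o c d = [ (λ r → r) , (λ r → contradiction (≅-trans (≅-sym (≅-weaken (divides (+ 2) refl) r)) N≅1) (≇-by (from-no (+ 4 ∣? -1ℤ - 1ℤ)))) ]′
  (two-is-square {u = u * u + v * v} {u * v} o (cop-* cu c) (mod (∣-mul 1ℤ d (lem u v))))
  where
  lem : ∀ u v → (u * u + v * v) * (u * u + v * v) - + 2 * (u * v * (u * v)) ≡ 1ℤ * ((u * u) * (u * u) + (v * v) * (v * v))
  lem = solve-∀
  lem′ : ∀ u v → (u * u) * (u * u) - -1ℤ * ((v * v) * (v * v)) ≡ 1ℤ * ((u * u) * (u * u) + (v * v) * (v * v))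
  lem′ = solve-∀
  lem″ : ∀ u → u * u * u * u ≡ (u * u) * (u * u)
  lem″ = solve-∀
  cu : Cop u N
  cu = cop-∣ (∣n⇒∣m*n (u * u * u) ∣-refl) (cop-≅ (≅-trans (≅-reflexive (lem″ u)) (mod (∣-mul 1ℤ d (lem′ u v)))) (cop-* cop--1 (cop-* (cop-* c c) (cop-* c c))))
  N≅1 : N ≅ 1ℤ [ + 4 ]
  N≅1 = sum-of-squares {u = u * u} {v * v} o (cop-* c c) d

-- Parity, powers, and factorisations by gcds

ℤ-parity : ∀ q → ∃[ p ] (q ≡ p * + 2 ⊎ q ≡ 1ℤ + p * + 2)
ℤ-parity q with q ℤ.%ℕ 2 | ℤ.n%ℕd<d q 2 | ℤ.a≡a%ℕn+[a/ℕn]*n q 2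
... | 0 | _ | e = q ℤ./ℕ 2 , inj₁ (trans e (ℤ.+-identityˡ _))
... | 1 | _ | e = q ℤ./ℕ 2 , inj₂ e
... | suc (suc _) | s≤s (s≤s ()) | _

Parity : ℕ → Set
Parity n = ∃[ h ] (n ≡ 2 ℕ.* h ⊎ n ≡ suc (2 ℕ.* h))

ℕ-parity : ∀ n → Parity n
ℕ-parity zero = 0 , inj₁ refl
ℕ-parity (suc n) with ℕ-parity n
... | h , inj₁ e = h , inj₂ (cong suc e)
... | h , inj₂ e = suc h , inj₁ (trans (cong suc e) (sym (ℕ.*-suc 2 h)))

odd-square : ∀ {a} → a ≅ 1ℤ [ + 2 ] → a * a ≅ 1ℤ [ + 8 ]
odd-square a≅1 with ≅-expand a≅1
... | q , refl with ℤ-parity q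
... | p , inj₁ refl = ≅-by (p * (1ℤ + + 2 * p)) (lem p)
  where
  lem : ∀ p → (1ℤ + p * + 2 * + 2) * (1ℤ + p * + 2 * + 2) ≡ 1ℤ + p * (1ℤ + + 2 * p) * + 8
  lem = solve-∀
... | p , inj₂ refl = ≅-by ((1ℤ + p) * (1ℤ + + 2 * p)) (lem p)
  where
  lem : ∀ p → (1ℤ + (1ℤ + p * + 2) * + 2) * (1ℤ + (1ℤ + p * + 2) * + 2) ≡ 1ℤ + (1ℤ + p) * (1ℤ + + 2 * p) * + 8
  lem = solve-∀

odd⇒≅1 : ∀ {N} → Odd N → N ≅ 1ℤ [ + 2 ]
odd⇒≅1 (h , refl) = ≅-by (+ h) (trans (odd-def h) (cong (_+_ 1ℤ) (ℤ.*-comm (+ 2) (+ h))))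

odd⇒pos : ∀ {N} → Odd N → Pos N
odd⇒pos (h , refl) = subst Pos (sym (odd≡ h)) (+<+ (s≤s z≤n))

¬cop-2 : ∀ {N} → + 2 ∣ N → ¬ Cop (+ 2) N
¬cop-2 {N} (divides q refl) (cop u v e) = from-no (+ 2 ∣? 1ℤ) (divides (u + v * q) (sym (trans (lem u v q) e)))
  where
  lem : ∀ u v q → (u + v * q) * + 2 ≡ u * + 2 + v * (q * + 2)
  lem = solve-∀

≅1⇒cop-2 : ∀ {N} → N ≅ 1ℤ [ + 2 ] → Cop (+ 2) N
≅1⇒cop-2 e = cop-sym (cop-≅ e cop-1ˡ)

pos⇒odd : ∀ {N} → Pos N → Cop (+ 2) N → Odd N
pos⇒odd {+ 0} (+<+ ())
pos⇒odd {+ suc i} _ c with ℕ-parity i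
... | h , inj₁ refl = h , sym (odd≡ h)
... | h , inj₂ refl = contradiction c (¬cop-2 (divides (+ suc h) (trans (cong +_ (trans (sym (ℕ.*-suc 2 h)) (ℕ.*-comm 2 (suc h)))) (ℤ.pos-* (suc h) 2))))

odd-∣ : ∀ {s N} → Pos s → s ∣ N → Odd N → Odd s
odd-∣ p d o = pos⇒odd p (cop-sym (cop-∣ d (cop-sym (cop-2 o))))

∣-*ˡ : ∀ {a} b → a ∣ a * b
∣-*ˡ {a} b = ∣m⇒∣m*n b (∣-refl {a})

∣-*ʳ : ∀ a {b} → b ∣ a * b
∣-*ʳ a = ∣n⇒∣m*n a ∣-refl

^-distrib-* : ∀ a b j → (a * b) ^ j ≡ a ^ j * b ^ j
^-distrib-* a b zero    = refl
^-distrib-* a b (suc j) = trans (cong (a * b *_) (^-distrib-* a b j)) (lem a b (a ^ j) (b ^ j))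
  where
  lem : ∀ a b p q → a * b * (p * q) ≡ a * p * (b * q)
  lem = solve-∀

^-suc-double : ∀ a j → a ^ suc (2 ℕ.* j) ≡ a * (a ^ j * a ^ j)
^-suc-double a j = cong (a *_) (trans (cong (a ^_) (cong (j ℕ.+_) (ℕ.+-identityʳ j))) (ℤ.^-distribˡ-+-* a j j))

^-double : ∀ a j → a ^ (2 ℕ.* j) ≡ a ^ j * a ^ j
^-double a j = trans (cong (a ^_) (cong (j ℕ.+_) (ℕ.+-identityʳ j))) (ℤ.^-distribˡ-+-* a j j)

≅1-^ : ∀ {a N} → a ≅ 1ℤ [ N ] → ∀ j → a ^ j ≅ 1ℤ [ N ]
≅1-^ e j = ≅-trans (≅-^ e j) (≅-reflexive (ℤ.^-zeroˡ j))

^-odd-≅ : ∀ {a b N} → a ≅ b [ N ] → b * b ≅ 1ℤ [ N ] → ∀ j → a ^ suc (2 ℕ.* j) ≅ b [ N ]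
^-odd-≅ {a} {b} e s j = ≅-trans (≅-^ e (suc (2 ℕ.* j))) (≅-trans (≅-reflexive (trans (^-suc-double b j) (cong (b *_) (sym (^-distrib-* b b j)))))
  (≅-trans (≅-* (≅-refl {b}) (≅1-^ s j)) (≅-reflexive (ℤ.*-identityʳ b))))

^-even-≅ : ∀ {a b N} → a ≅ b [ N ] → b * b ≅ 1ℤ [ N ] → ∀ j → a ^ (2 ℕ.* j) ≅ 1ℤ [ N ]
^-even-≅ {a} {b} e s j = ≅-trans (≅-^ e (2 ℕ.* j)) (≅-trans (≅-reflexive (trans (^-double b j) (sym (^-distrib-* b b j)))) (≅1-^ s j))

-- Stands in for prime factorisation: with s = gcd(t, D), the cofactor t/s is coprime to D/s and so
-- divides E.
split : ∀ {t D E} → Pos t → t ∣ D * E →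
  ∃[ s ] ∃[ t′ ] Pos s × Pos t′ × t ≡ s * t′ × s ∣ D × t′ ∣ E
split {t} {D} {E} p d = g , a′ , pos , pos-*-cancelˡ pos (subst Pos eqˡ p) , eqˡ ,
  divides b′ (trans eqʳ (ℤ.*-comm g b′)) , cop-∣-* coprime (cancel d)
  where
  open GCD (gcd t D p)
  cancel : t ∣ D * E → a′ ∣ b′ * E
  cancel (divides q e) = divides q (*-cancelˡ g pos (trans (sym (ℤ.*-assoc g b′ E)) (trans (cong (_* E) (sym eqʳ)) (trans e (trans (cong (q *_) eqˡ) (lem q g a′))))))
    where
    lem : ∀ q g a → q * (g * a) ≡ g * (q * a)
    lem = solve-∀

-- The root is g = gcd(b, S). The cofactor b/g divides R and is therefore coprime to S, while g is
-- coprime to R; hence S and the power of g divide each other.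
coprime-power : ∀ {S R b} y → Pos S → Pos b → S * R ≡ b ^ suc y → Cop S R →
  ∃[ g ] ∃[ r ] Pos g × b ≡ g * r × S ≡ g ^ suc y × R ≡ r ^ suc y
coprime-power {S} {R} {b} y pS pb eq c = g , a′ , pos , eqˡ , S≡ ,
  *-cancelˡ S pS (trans eq (trans bʸ (cong (_* a′ ^ suc y) (sym S≡))))
  where
  open GCD (gcd b S pb)
  bʸ : b ^ suc y ≡ g ^ suc y * a′ ^ suc y
  bʸ = trans (cong (_^ suc y) eqˡ) (^-distrib-* g a′ (suc y))
  a′∣R : a′ ∣ R
  a′∣R = cop-∣-* coprime (cancel (subst (b ∣_) (sym eq) (∣-*ˡ (b ^ y))))
    where
    lem : ∀ q g a → q * (g * a) ≡ g * (q * a)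
    lem = solve-∀
    cancel : b ∣ S * R → a′ ∣ b′ * R
    cancel (divides q e) = divides q (*-cancelˡ g pos (trans (sym (ℤ.*-assoc g b′ R)) (trans (cong (_* R) (sym eqʳ)) (trans e (trans (cong (q *_) eqˡ) (lem q g a′))))))
  g∣S : g ∣ S
  g∣S = divides b′ (trans eqʳ (ℤ.*-comm g b′))
  S≡ : S ≡ g ^ suc y
  S≡ = ∣-antisym pS (pos-^ pos (suc y))
    (cop-∣-* (cop-sym (cop-^ (suc y) (cop-sym (cop-∣₂ ∣-refl a′∣R c)))) (subst (S ∣_) (trans eq (trans bʸ (ℤ.*-comm (g ^ suc y) (a′ ^ suc y)))) (∣-*ˡ R)))
    (cop-∣-* {g ^ suc y} {R} {S} (cop-^ (suc y) (cop-∣₂ g∣S ∣-refl c)) (subst (g ^ suc y ∣_) (trans (sym bʸ) (trans (sym eq) (ℤ.*-comm S R))) (∣-*ˡ (a′ ^ suc y))))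

-- Iterated squaring

sq : ℕ → ℤ → ℤ
sq zero    u = u
sq (suc i) u = sq i u * sq i u

sq-* : ∀ i u v → sq i (u * v) ≡ sq i u * sq i v
sq-* zero    u v = refl
sq-* (suc i) u v = trans (cong₂ _*_ (sq-* i u v) (sq-* i u v)) (lem (sq i u) (sq i v))
  where
  lem : ∀ p q → p * q * (p * q) ≡ p * p * (q * q)
  lem = solve-∀

sq-≅ : ∀ i {u v N} → u ≅ v [ N ] → sq i u ≅ sq i v [ N ]
sq-≅ zero    e = e
sq-≅ (suc i) e = ≅-* (sq-≅ i e) (sq-≅ i e)

sq-cop : ∀ i {u N} → Cop u N → Cop (sq i u) N
sq-cop zero    c = c
sq-cop (suc i) c = cop-* (sq-cop i c) (sq-cop i c)

sq-pos : ∀ i {u} → Pos u → Pos (sq i u)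
sq-pos zero    p = p
sq-pos (suc i) p = pos-* (sq-pos i p) (sq-pos i p)

sq-^ : ∀ i u → sq i u ≡ u ^ (2 ℕ.^ i)
sq-^ zero    u = sym (ℤ.*-identityʳ u)
sq-^ (suc i) u = trans (cong₂ _*_ (sq-^ i u) (sq-^ i u)) (sym (^-double u (2 ℕ.^ i)))

-- The cofactor of u - v in u^(2^i) - v^(2^i), kept as the product of the u^(2^j) + v^(2^j) with j <
-- i, so that its divisors can be split along the factors.
sums : ℕ → ℤ → ℤ → ℤ
sums zero    u v = 1ℤ
sums (suc i) u v = sums i u v * (sq i u + sq i v)

sq-diff : ∀ i u v → sq i u - sq i v ≡ (u - v) * sums i u v
sq-diff zero    u v = sym (ℤ.*-identityʳ (u - v))
sq-diff (suc i) u v = trans (lem (sq i u) (sq i v)) (trans (cong (_* (sq i u + sq i v)) (sq-diff i u v)) (ℤ.*-assoc (u - v) _ _))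
  where
  lem : ∀ p q → p * p - q * q ≡ (p - q) * (p + q)
  lem = solve-∀

record TwoPart (x z : ℕ) : Set where
  field
    f X Z : ℕ
    x≡    : x ≡ X ℕ.* 2 ℕ.^ f
    z≡    : z ≡ Z ℕ.* 2 ℕ.^ f
    odd∨  : (∃[ h ] X ≡ suc (2 ℕ.* h)) ⊎ (∃[ h ] Z ≡ suc (2 ℕ.* h))

two-part : ∀ x z → 0 ℕ.< x → TwoPart x z
two-part x z = go x x z ℕ.≤-refl
  where
  double : ∀ {w W} f → w ≡ W ℕ.* 2 ℕ.^ f → 2 ℕ.* w ≡ W ℕ.* 2 ℕ.^ suc f
  double {w} {W} f e = trans (cong (2 ℕ.*_) e) (trans (sym (ℕ.*-assoc 2 W (2 ℕ.^ f))) (trans (cong (ℕ._* 2 ℕ.^ f) (ℕ.*-comm 2 W)) (ℕ.*-assoc W 2 (2 ℕ.^ f))))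
  -- Halving is not structural recursion; the bound `k` on `x` is what decreases.
  go : ∀ k x z → x ℕ.≤ k → 0 ℕ.< x → TwoPart x z
  go k x z x≤k 0<x with ℕ-parity x | ℕ-parity z
  ... | h , inj₂ e | _ = record { f = 0 ; X = x ; Z = z ; x≡ = sym (ℕ.*-identityʳ x) ; z≡ = sym (ℕ.*-identityʳ z) ; odd∨ = inj₁ (h , e) }
  ... | _ | h , inj₂ e = record { f = 0 ; X = x ; Z = z ; x≡ = sym (ℕ.*-identityʳ x) ; z≡ = sym (ℕ.*-identityʳ z) ; odd∨ = inj₂ (h , e) }
  go k .(2 ℕ.* zero) z x≤k () | zero , inj₁ refl | h′ , inj₁ refl
  go (suc k) .(2 ℕ.* suc h) .(2 ℕ.* h′) (s≤s x≤k) 0<x | suc h , inj₁ refl | h′ , inj₁ refl =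
    record { f = suc f ; X = X ; Z = Z ; x≡ = double {W = X} f x≡ ; z≡ = double {W = Z} f z≡ ; odd∨ = odd∨ }
    where
    open TwoPart (go k (suc h) h′ (ℕ.≤-trans (ℕ.≤-trans (s≤s (ℕ.m≤m+n h 0)) (ℕ.m≤n+m (suc (h ℕ.+ 0)) h)) x≤k) (s≤s z≤n))

square-nonneg : ∀ u → 0ℤ ≤ u * u
square-nonneg (+ zero)  = +≤+ z≤n
square-nonneg (+ suc u) = +≤+ z≤n
square-nonneg -[1+ u ]  = +≤+ z≤n

sq-odd-power : ∀ i u ζ → sq i ((u * u) ^ suc (2 ℕ.* ζ)) ≡ (sq i u * sq i u) * ((sq i (u ^ ζ) * sq i (u ^ ζ)) * (sq i (u ^ ζ) * sq i (u ^ ζ)))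
sq-odd-power i u ζ = begin
  sq i ((u * u) ^ suc (2 ℕ.* ζ))               ≡⟨ cong (sq i) (trans (^-suc-double (u * u) ζ) (cong (u * u *_) (cong₂ _*_ (^-distrib-* u u ζ) (^-distrib-* u u ζ)))) ⟩
  sq i (u * u * (p * p * (p * p)))             ≡⟨ sq-* i (u * u) _ ⟩
  sq i (u * u) * sq i (p * p * (p * p))        ≡⟨ cong₂ _*_ (sq-* i u u) (trans (sq-* i (p * p) (p * p)) (cong₂ _*_ (sq-* i p p) (sq-* i p p))) ⟩
  _ ∎
  where
  open ≡-Reasoning
  p = u ^ ζ

-- For odd exponents both summands are u² times a fourth power.
power-sum-mod-8 : ∀ {t} i u ζ ξ → Odd t → Cop u t →
  t ∣ sq i ((u * u) ^ suc (2 ℕ.* ζ)) + sq i ((u * u) ^ suc (2 ℕ.* ξ)) → t ≅ 1ℤ [ + 8 ]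
power-sum-mod-8 {t} i u ζ ξ o c d = sum-of-fourth-powers {t} {p} {q} o (sq-cop i (cop-^ ξ c))
  (cop-∣-* (cop-sym (cop-* cu cu)) (subst (t ∣_)
    (trans (cong₂ _+_ (sq-odd-power i u ζ) (sq-odd-power i u ξ)) (sym (ℤ.*-distribˡ-+ (sq i u * sq i u) ((p * p) * (p * p)) ((q * q) * (q * q))))) d))
  where
  p = sq i (u ^ ζ)
  q = sq i (u ^ ξ)
  cu = sq-cop i c

neg-^ : ∀ u j → (- u) ^ suc (2 ℕ.* j) ≡ - (u ^ suc (2 ℕ.* j))
neg-^ u j = trans (^-suc-double (- u) j) (trans (cong (- u *_) (trans (sym (^-distrib-* (- u) (- u) j)) (trans (cong (_^ j) (lem u)) (^-distrib-* u u j))))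
  (trans (sym (ℤ.neg-distribˡ-* u _)) (cong -_ (sym (^-suc-double u j)))))
  where
  lem : ∀ u → - u * - u ≡ u * u
  lem = solve-∀

sums-pos : ∀ i {u v} → Pos u → Pos v → Pos (sums i u v)
sums-pos zero    p q = +<+ (s≤s z≤n)
sums-pos (suc i) p q = pos-* (sums-pos i p q) (pos-+ (sq-pos i p) (sq-pos i q))

-- Modulo N each factor of the product becomes 2u^(2^j).
sums-cop : ∀ i {u v N} → u ≅ v [ N ] → Cop (+ 2) N → Cop u N → Cop (sums i u v) N
sums-cop zero    e c d = cop-1ˡ
sums-cop (suc i) {u} {v} e c d = cop-* (sums-cop i e c d) (cop-≅
  (≅-trans (≅-+ (≅-refl {sq i u}) (sq-≅ i (≅-sym e))) (≅-reflexive (lem (sq i u)))) (cop-* c (sq-cop i d)))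
  where
  lem : ∀ x → x + x ≡ + 2 * x
  lem = solve-∀

half-difference-cop : ∀ {u v S} → u - v ≡ + 2 * S → Cop u v → Cop u S
half-difference-cop {u} {v} {S} e c = cop-sym (cop-∣ (∣-*ʳ (- (+ 2))) (cop-≅ (≅-by -1ℤ (trans (sym (ℤ.neg-distribˡ-* (+ 2) S)) (trans (cong -_ (sym e)) (lem u v)))) (cop-sym c)))
  where
  lem : ∀ u v → - (u - v) ≡ v + -1ℤ * u
  lem = solve-∀

-- Exact powers of 2 and size estimates

square-mod-16 : ∀ {u r} → u ≅ r [ + 8 ] → u * u ≅ r * r [ + 16 ]
square-mod-16 {u} {r} e = ≅-by (r * q + + 4 * (q * q)) (trans (cong₂ _*_ (proj₂ (≅-expand e)) (proj₂ (≅-expand e))) (lem r q))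
  where
  q = proj₁ (≅-expand e)
  lem : ∀ r q → (r + q * + 8) * (r + q * + 8) ≡ r * r + (r * q + + 4 * (q * q)) * + 16
  lem = solve-∀

square-mod-32 : ∀ {u r} → u ≅ r [ + 16 ] → u * u ≅ r * r [ + 32 ]
square-mod-32 {u} {r} e = ≅-by (r * q + + 8 * (q * q)) (trans (cong₂ _*_ (proj₂ (≅-expand e)) (proj₂ (≅-expand e))) (lem r q))
  where
  q = proj₁ (≅-expand e)
  lem : ∀ r q → (r + q * + 16) * (r + q * + 16) ≡ r * r + (r * q + + 8 * (q * q)) * + 32
  lem = solve-∀

-- Since p + r ≡ 2 (mod 4), one squaring adds exactly one factor 2.
two-adic-step : ∀ {p r P o} → p ≅ 1ℤ [ + 4 ] → r ≅ 1ℤ [ + 4 ] → o ≅ 1ℤ [ + 2 ] → p - r ≡ P * o →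
  ∃[ o′ ] o′ ≅ 1ℤ [ + 2 ] × p * p - r * r ≡ + 2 * P * o′
two-adic-step {p} {r} {P} {o} p≅1 r≅1 o≅1 eq = go (≅-expand (≅-+ p≅1 r≅1))
  where
  open ≡-Reasoning
  lem₁ : ∀ p r → p * p - r * r ≡ (p - r) * (p + r)
  lem₁ = solve-∀
  lem₂ : ∀ q → + 2 + q * + 4 ≡ + 2 * (1ℤ + q * + 2)
  lem₂ = solve-∀
  lem₃ : ∀ t o x → t * o * (+ 2 * x) ≡ + 2 * t * (o * x)
  lem₃ = solve-∀
  go : ∃[ q ] p + r ≡ + 2 + q * + 4 → ∃[ o′ ] o′ ≅ 1ℤ [ + 2 ] × p * p - r * r ≡ + 2 * P * o′
  go (q , e) = o * (1ℤ + q * + 2) , ≅-* {d = 1ℤ} o≅1 (≅-by q refl) , (begin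
    p * p - r * r                     ≡⟨ lem₁ p r ⟩
    (p - r) * (p + r)                 ≡⟨ cong₂ _*_ eq (trans e (lem₂ q)) ⟩
    P * o * (+ 2 * (1ℤ + q * + 2))    ≡⟨ lem₃ P o (1ℤ + q * + 2) ⟩
    + 2 * P * (o * (1ℤ + q * + 2)) ∎)

sq-≅1 : ∀ i {w} → w ≅ 1ℤ [ + 2 ] → sq i w ≅ 1ℤ [ + 2 ]
sq-≅1 zero    e = e
sq-≅1 (suc i) {w} e = ≅-* (sq-≅1 i {w} e) (sq-≅1 i {w} e)

sq-two-adic : ∀ f {u v} → u ≅ 1ℤ [ + 2 ] → v ≅ 1ℤ [ + 2 ] → u * u - v * v ≅ + 16 [ + 32 ] →
  ∃[ o ] o ≅ 1ℤ [ + 2 ] × sq (suc f) u - sq (suc f) v ≡ (+ 2) ^ (4 ℕ.+ f) * o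
sq-two-adic zero u≅1 v≅1 e = 1ℤ + q * + 2 , ≅-by q refl , trans (proj₂ (≅-expand e)) (lem q)
  where
  q = proj₁ (≅-expand e)
  lem : ∀ q → + 16 + q * + 32 ≡ + 16 * (1ℤ + q * + 2)
  lem = solve-∀
sq-two-adic (suc f) u≅1 v≅1 e with sq-two-adic f u≅1 v≅1 e
... | o , o≅1 , eq = two-adic-step {P = (+ 2) ^ (4 ℕ.+ f)} (square≅1 u≅1) (square≅1 v≅1) o≅1 eq
  where
  square≅1 : ∀ {w} → w ≅ 1ℤ [ + 2 ] → sq (suc f) w ≅ 1ℤ [ + 4 ]
  square≅1 {w} w≅1 = ≅-weaken (divides (+ 2) refl) (odd-square (sq-≅1 f {w} w≅1))

two-adic-≤ : ∀ i j {o w} → o ≅ 1ℤ [ + 2 ] → (+ 2) ^ i * o ≡ (+ 2) ^ j * w → j ℕ.≤ i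
two-adic-≤ i j {o} {w} o≅1 eq = ℕ.≮⇒≥ λ i<j → ¬cop-2 (divides ((+ 2) ^ (j ℕ.∸ suc i) * w) (2∣o i<j)) (≅1⇒cop-2 o≅1)
  where
  lem : ∀ s t w → + 2 * s * t * w ≡ s * (t * w * + 2)
  lem = solve-∀
  2∣o : i ℕ.< j → o ≡ (+ 2) ^ (j ℕ.∸ suc i) * w * + 2
  2∣o i<j = *-cancelˡ ((+ 2) ^ i) (pos-^ (+<+ (s≤s z≤n)) i) (trans eq (trans
    (cong (_* w) (trans (cong ((+ 2) ^_) (sym (ℕ.m+[n∸m]≡n i<j))) (ℤ.^-distribˡ-+-* (+ 2) (suc i) (j ℕ.∸ suc i))))
    (lem ((+ 2) ^ i) ((+ 2) ^ (j ℕ.∸ suc i)) w)))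

pos-≤-* : ∀ {d s} → Pos d → Pos s → s ≤ d * s
pos-≤-* {+ suc d} {+ suc s} _ _ = +≤+ (s≤s (ℕ.m≤m+n s _))
pos-≤-* {+ 0} (+<+ ())
pos-≤-* {+ suc d} {+ 0} _ (+<+ ())

^-monoʳ : ∀ {c i j} → Pos c → i ℕ.≤ j → c ^ i ≤ c ^ j
^-monoʳ {c} {i} {j} p i≤j = subst (c ^ i ≤_)
  (trans (sym (ℤ.^-distribˡ-+-* c (j ℕ.∸ i) i)) (cong (c ^_) (ℕ.m∸n+n≡m i≤j))) (pos-≤-* (pos-^ p (j ℕ.∸ i)) (pos-^ p i))

pos-nonNeg : ∀ {a} → Pos a → ℤ.NonNegative a
pos-nonNeg p = ℤ.nonNegative (ℤ.<⇒≤ p)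

^-monoˡ : ∀ {b c} j → Pos b → b ≤ c → b ^ j ≤ c ^ j
^-monoˡ zero p b≤c = ℤ.≤-refl
^-monoˡ {b} {c} (suc j) p b≤c = ℤ.≤-trans (ℤ.*-monoˡ-≤-nonNeg b {{pos-nonNeg p}} (^-monoˡ j p b≤c))
  (ℤ.*-monoʳ-≤-nonNeg (c ^ j) {{pos-nonNeg (pos-^ (ℤ.<-≤-trans p b≤c) j)}} b≤c)

-- The factor p - q is a positive integer, so the difference is at least p + q.
<-square-difference : ∀ {p q} → Pos p → Pos q → Pos (p * p - q * q) → p < p * p - q * q
<-square-difference {p} {q} pp pq pd = ℤ.<-≤-trans (subst (_< p + q) (ℤ.+-identityʳ p) (ℤ.+-monoʳ-< p pq))
  (subst (p + q ≤_) (sym (lem p q)) (pos-≤-* (pos-*-cancelˡ p+q (subst Pos (trans (lem p q) (ℤ.*-comm (p - q) (p + q))) pd)) p+q))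
  where
  p+q = pos-+ pp pq
  lem : ∀ p q → p * p - q * q ≡ (p - q) * (p + q)
  lem = solve-∀

n<2^n : ∀ n → n ℕ.< 2 ℕ.^ n
n<2^n zero    = s≤s z≤n
n<2^n (suc n) = ℕ.≤-trans (s≤s (n<2^n n)) (ℕ.≤-trans (ℕ.+-monoˡ-≤ (2 ℕ.^ n) (ℕ.m^n>0 2 n)) (ℕ.≤-reflexive (cong (2 ℕ.^ n ℕ.+_) (sym (ℕ.+-identityʳ _)))))

-- The triple a, b, c: coprimality and congruences

module Triple (m n k : ℤ) (m≡ : m ≡ + 4 * k) (odd-k : Odd k) (odd-n : Odd n) (m⊥n : Cop m n)
  (a b c : ℤ) (a≡ : a ≡ m * m - n * n) (b≡ : b ≡ + 2 * m * n) (c≡ : c ≡ m * m + n * n) where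

  pos-m : Pos m
  pos-m = subst Pos (sym m≡) (pos-* {+ 4} (+<+ (s≤s z≤n)) (odd⇒pos odd-k))

  pos-n : Pos n
  pos-n = odd⇒pos odd-n

  pos-b : Pos b
  pos-b = subst Pos (sym b≡) (pos-* (pos-* {+ 2} (+<+ (s≤s z≤n)) pos-m) pos-n)

  pos-c : Pos c
  pos-c = subst Pos (sym c≡) (pos-+ (pos-* pos-m pos-m) (pos-* pos-n pos-n))

  b≡8kn : b ≡ + 8 * (k * n)
  b≡8kn = trans b≡ (trans (cong (λ t → + 2 * t * n) m≡) (lem k n))
    where
    lem : ∀ k n → + 2 * (+ 4 * k) * n ≡ + 8 * (k * n)
    lem = solve-∀

  m²≅0 : m * m ≅ 0ℤ [ + 16 ]
  m²≅0 = ≅-by (k * k) (trans (cong₂ _*_ m≡ m≡) (lem k))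
    where
    lem : ∀ k → + 4 * k * (+ 4 * k) ≡ 0ℤ + k * k * + 16
    lem = solve-∀

  c≅n² : ∀ {N} → N ∣ m → c ≅ n * n [ N ]
  c≅n² d = ≅-trans (≅-reflexive c≡) (≅-trans (≅-+ (∣⇒≅0 (∣n⇒∣m*n m d)) ≅-refl) (≅-reflexive (ℤ.+-identityˡ (n * n))))

  a≅-n² : ∀ {N} → N ∣ m → a ≅ - (n * n) [ N ]
  a≅-n² d = ≅-trans (≅-reflexive a≡) (≅-trans (≅-- (∣⇒≅0 (∣n⇒∣m*n m d)) ≅-refl) (≅-reflexive (ℤ.+-identityˡ (- (n * n)))))

  c≅m² : ∀ {N} → N ∣ n → c ≅ m * m [ N ]
  c≅m² d = ≅-trans (≅-reflexive c≡) (≅-trans (≅-+ (≅-refl {m * m}) (∣⇒≅0 (∣n⇒∣m*n n d))) (≅-reflexive (ℤ.+-identityʳ (m * m))))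

  a≅m² : ∀ {N} → N ∣ n → a ≅ m * m [ N ]
  a≅m² d = ≅-trans (≅-reflexive a≡) (≅-trans (≅-- (≅-refl {m * m}) (∣⇒≅0 (∣n⇒∣m*n n d))) (≅-reflexive (ℤ.+-identityʳ (m * m))))

  c⊥m : Cop c m
  c⊥m = cop-≅ (c≅n² ∣-refl) (cop-* (cop-sym m⊥n) (cop-sym m⊥n))

  c⊥n : Cop c n
  c⊥n = cop-≅ (c≅m² ∣-refl) (cop-* m⊥n m⊥n)

  c≅1mod8 : c ≅ 1ℤ [ + 8 ]
  c≅1mod8 = ≅-trans (≅-reflexive c≡) (≅-+ {c = n * n} (≅-weaken {N = + 16} (divides (+ 2) refl) m²≅0) (odd-square (odd⇒≅1 odd-n)))

  a≅-1mod8 : a ≅ -1ℤ [ + 8 ]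
  a≅-1mod8 = ≅-trans (≅-reflexive a≡) (≅-- {c = n * n} (≅-weaken {N = + 16} (divides (+ 2) refl) m²≅0) (odd-square (odd⇒≅1 odd-n)))

  2⊥c : Cop (+ 2) c
  2⊥c = ≅1⇒cop-2 (≅-weaken (divides (+ 4) refl) c≅1mod8)

  2⊥a : Cop (+ 2) a
  2⊥a = ≅1⇒cop-2 (≅-trans (≅-weaken (divides (+ 4) refl) a≅-1mod8) (≅-by -1ℤ refl))

  c⊥b : Cop c b
  c⊥b = subst (Cop c) (sym b≡) (cop-sym (cop-* (cop-* 2⊥c (cop-sym c⊥m)) (cop-sym c⊥n)))

  a⊥c : Cop a c
  a⊥c = cop-≅ (≅-by -1ℤ (trans a≡ (trans (lem m n) (cong (λ t → + 2 * (m * m) + -1ℤ * t) (sym c≡))))) (cop-* 2⊥c (cop-* (cop-sym c⊥m) (cop-sym c⊥m)))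
    where
    lem : ∀ m n → m * m - n * n ≡ + 2 * (m * m) + -1ℤ * (m * m + n * n)
    lem = solve-∀

  b≤c : b ≤ c
  b≤c = subst₂ _≤_ (sym b≡) (sym c≡) (ℤ.0≤i-j⇒j≤i (subst (0ℤ ≤_) (lem m n) (square-nonneg (m - n))))
    where
    lem : ∀ m n → (m - n) * (m - n) ≡ m * m + n * n - + 2 * m * n
    lem = solve-∀

  -- Case n ≡ ±3 (mod 8): odd y is impossible

  module EvenExponents (pos-a : Pos a) (n²≅9 : n * n ≅ + 9 [ + 16 ]) where

    c≅9 : c ≅ + 9 [ + 16 ]
    c≅9 = ≅-trans (≅-reflexive c≡) (≅-+ {c = n * n} m²≅0 n²≅9)

    a≅7 : a ≅ + 7 [ + 16 ]
    a≅7 = ≅-trans (≅-reflexive a≡) (≅-trans (≅-- {c = n * n} m²≅0 n²≅9) (≅-by -1ℤ refl))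

    9² : + 9 * + 9 ≅ 1ℤ [ + 16 ]
    9² = ≅-by (+ 5) refl

    7² : + 7 * + 7 ≅ 1ℤ [ + 16 ]
    7² = ≅-by (+ 3) refl

    -- Split t along the factors of the product. Modulo a divisor of n both c and a are m², so every
    -- factor is a sum covered by `power-sum-mod-8`.
    sums-mod-8 : ∀ {t} f ζ ξ → Odd t → t ∣ n → t ∣ sums f (c ^ suc (2 ℕ.* ζ)) (a ^ suc (2 ℕ.* ξ)) → t ≅ 1ℤ [ + 8 ]
    sums-mod-8 {t} zero ζ ξ o t∣n t∣1 = ≅-reflexive (∣-antisym (odd⇒pos o) (+<+ (s≤s z≤n)) t∣1 (divides t (sym (ℤ.*-identityʳ t))))
    sums-mod-8 {t} (suc f) ζ ξ o t∣n d with split (odd⇒pos o) d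
    ... | s , t′ , ps , pt′ , refl , s∣ , t′∣ = ≅-* (sums-mod-8 f ζ ξ (odd-∣ ps (∣-*ˡ t′) o) (∣-trans (∣-*ˡ t′) t∣n) s∣)
      (power-sum-mod-8 f m ζ ξ (odd-∣ pt′ (∣-*ʳ s) o) (cop-∣₂ ∣-refl t′∣n m⊥n)
        (∣-resp-≅ (≅-+ (sq-≅ f (≅-^ (c≅m² t′∣n) (suc (2 ℕ.* ζ)))) (sq-≅ f (≅-^ (a≅m² t′∣n) (suc (2 ℕ.* ξ))))) t′∣))
      where
      t′∣n = ∣-trans (∣-*ʳ s) t∣n

    -- S is the y-th power of g = gcd(b, S). With g₂ = gcd(g, n), both g / g₂, which divides m, and n / g₂, which divides R, are ≡ 1 (mod 8).
    both-odd-core : ∀ D R S y → D ≡ + 2 * S → S ≅ 1ℤ [ + 8 ] → Pos S → S * (+ 2 * R) ≡ b ^ suc (2 ℕ.* y) → Cop S (+ 2 * R) →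
      (∀ {t} → Odd t → t ∣ n → t ∣ R → t ≅ 1ℤ [ + 8 ]) → (∀ {t} → Odd t → t ∣ m → t ∣ D → t ≅ 1ℤ [ + 8 ]) → n ≅ 1ℤ [ + 8 ]
    both-odd-core D R S y 2S≡ S≅1 pos-S SR S⊥2R on-n on-m = n≅1
      where
      2⊥S : Cop (+ 2) S
      2⊥S = ≅1⇒cop-2 (≅-weaken (divides (+ 4) refl) S≅1)
      odd-S : Odd S
      odd-S = pos⇒odd pos-S 2⊥S
      power = coprime-power (2 ℕ.* y) pos-S pos-b SR S⊥2R
      g = proj₁ power
      r = proj₁ (proj₂ power)
      pos-g = proj₁ (proj₂ (proj₂ power))
      b≡gr = proj₁ (proj₂ (proj₂ (proj₂ power)))
      S≡ = proj₁ (proj₂ (proj₂ (proj₂ (proj₂ power))))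
      2R≡ = proj₂ (proj₂ (proj₂ (proj₂ (proj₂ power))))
      open GCD (gcd g n pos-g) renaming (g to g₂; a′ to g₁; b′ to t; pos to pos-g₂; eqˡ to g≡; eqʳ to n≡; coprime to g₁⊥t)
      2mt≡g₁r : + 2 * m * t ≡ g₁ * r
      2mt≡g₁r = *-cancelˡ g₂ pos-g₂ (trans (lem g₂ m t) (trans (cong (+ 2 * m *_) (sym n≡)) (trans (sym b≡) (trans b≡gr (trans (cong (_* r) g≡) (ℤ.*-assoc g₂ g₁ r))))))
        where
        lem : ∀ g m t → g * (+ 2 * m * t) ≡ + 2 * m * (g * t)
        lem = solve-∀
      odd-t : Odd t
      odd-t = odd-∣ (pos-*-cancelˡ pos-g₂ (subst Pos n≡ pos-n)) (divides g₂ n≡) odd-n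
      t∣R : t ∣ R
      t∣R = cop-∣-* (cop-sym (cop-2 odd-t)) (subst (t ∣_) (sym 2R≡)
        (∣m⇒∣m*n (r ^ (2 ℕ.* y)) (cop-∣-* (cop-sym g₁⊥t) (divides (+ 2 * m) (sym 2mt≡g₁r)))))
      t≅1 : t ≅ 1ℤ [ + 8 ]
      t≅1 = on-n odd-t (divides g₂ n≡) t∣R
      g₁∣S : g₁ ∣ S
      g₁∣S = ∣-trans (divides g₂ g≡) (subst (g ∣_) (sym S≡) (∣-*ˡ (g ^ (2 ℕ.* y))))
      odd-g₁ : Odd g₁
      odd-g₁ = odd-∣ (pos-*-cancelˡ pos-g₂ (subst Pos g≡ pos-g)) g₁∣S odd-S
      g₁∣m : g₁ ∣ m
      g₁∣m = cop-∣-* (cop-sym (cop-2 odd-g₁)) (cop-∣-* {g₁} {t} {+ 2 * m} g₁⊥t (divides r (trans (ℤ.*-comm t (+ 2 * m)) (trans 2mt≡g₁r (ℤ.*-comm g₁ r)))))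
      g₁≅1 : g₁ ≅ 1ℤ [ + 8 ]
      g₁≅1 = on-m odd-g₁ g₁∣m (subst (g₁ ∣_) (sym 2S≡) (∣n⇒∣m*n (+ 2) g₁∣S))
      -- The exponent is odd and g² ≡ 1 (mod 8), so g is congruent to its power S.
      g≅1 : g ≅ 1ℤ [ + 8 ]
      g≅1 = ≅-trans (≅-sym (^-odd-≅ ≅-refl (odd-square (odd⇒≅1 (odd-∣ pos-g (subst (g ∣_) (sym S≡) (∣-*ˡ (g ^ (2 ℕ.* y)))) odd-S))) y))
        (≅-trans (≅-reflexive (sym S≡)) S≅1)
      g₂≅1 : g₂ ≅ 1ℤ [ + 8 ]
      g₂≅1 = ≅-trans (≅-reflexive (sym (ℤ.*-identityʳ g₂))) (≅-trans (≅-* (≅-refl {g₂}) (≅-sym g₁≅1)) (≅-trans (≅-reflexive (sym g≡)) g≅1))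
      n≅1 : n ≅ 1ℤ [ + 8 ]
      n≅1 = ≅-trans (≅-reflexive n≡) (≅-* g₂≅1 t≅1)

    both-odd : ∀ f ζ ξ y → sq f (c ^ suc (2 ℕ.* ζ)) - sq f (a ^ suc (2 ℕ.* ξ)) ≡ b ^ suc (2 ℕ.* y) → n ≅ 1ℤ [ + 8 ]
    both-odd f ζ ξ y eq = go (c ^ Z) (a ^ X) (pos-^ pos-c Z) (pos-^ pos-a X)
      (≅-- (^-odd-≅ c≅9 9² ζ) (^-odd-≅ a≅7 7² ξ)) (cop-^ Z (cop-sym (cop-^ X a⊥c))) eq
      (sums-mod-8 f ζ ξ)
      -- Modulo a divisor of m, c ≡ n² and a ≡ -n²; X being odd, C - A turns into the sum n^(2Z) +
      -- n^(2X).
      λ {t} o t∣m d → power-sum-mod-8 0 n ζ ξ o (cop-sym (cop-∣ t∣m m⊥n))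
        (∣-resp-≅ (≅-trans (≅-- (≅-^ (c≅n² t∣m) Z) (≅-^ (a≅-n² t∣m) X))
            (≅-reflexive (trans (cong (λ t → (n * n) ^ Z - t) (neg-^ (n * n) ξ)) (cong (_+_ ((n * n) ^ Z)) (ℤ.neg-involutive _))))) d)
      where
      Z = suc (2 ℕ.* ζ)
      X = suc (2 ℕ.* ξ)
      lem₁ : ∀ u → + 9 - + 7 + u * + 16 ≡ + 2 * (1ℤ + u * + 8)
      lem₁ = solve-∀
      lem₂ : ∀ s r → + 2 * s * r ≡ s * (+ 2 * r)
      lem₂ = solve-∀
      go : ∀ C A → Pos C → Pos A → C - A ≅ + 9 - + 7 [ + 16 ] → Cop C A → sq f C - sq f A ≡ b ^ suc (2 ℕ.* y) →
        (∀ {t} → Odd t → t ∣ n → t ∣ sums f C A → t ≅ 1ℤ [ + 8 ]) → (∀ {t} → Odd t → t ∣ m → t ∣ C - A → t ≅ 1ℤ [ + 8 ]) → n ≅ 1ℤ [ + 8 ]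
      go C A pC pA D≅ C⊥A eq = both-odd-core (C - A) R S y 2S≡ S≅1 pos-S SR
        (cop-sym (cop-* 2⊥S (sums-cop f C≅A 2⊥S (half-difference-cop 2S≡ C⊥A))))
        where
        R = sums f C A
        -- Half of C - A = 9 - 7 + 16u.
        S = 1ℤ + proj₁ (≅-expand D≅) * + 8
        2S≡ : C - A ≡ + 2 * S
        2S≡ = trans (proj₂ (≅-expand D≅)) (lem₁ (proj₁ (≅-expand D≅)))
        S≅1 : S ≅ 1ℤ [ + 8 ]
        S≅1 = ≅-by (proj₁ (≅-expand D≅)) refl
        2⊥S : Cop (+ 2) S
        2⊥S = ≅1⇒cop-2 (≅-weaken (divides (+ 4) refl) S≅1)
        C≅A : C ≅ A [ S ]
        C≅A = mod (subst (S ∣_) (sym 2S≡) (∣-*ʳ (+ 2)))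
        SR : S * (+ 2 * R) ≡ b ^ suc (2 ℕ.* y)
        SR = trans (sym (lem₂ S R)) (trans (cong (_* R) (sym 2S≡)) (trans (sym (sq-diff f C A)) eq))
        pos-S : Pos S
        pos-S = pos-*-cancelˡ (pos-* {+ 2} (+<+ (s≤s z≤n)) (sums-pos f pC pA))
          (subst Pos (trans (sym SR) (ℤ.*-comm S (+ 2 * R))) (pos-^ pos-b (suc (2 ℕ.* y))))

    -- The difference contains 2 exactly 4 + f times and b^y at least 3y times; y ≥ 2 then gives y ≤
    -- f < 2^f. So p = c^(Z·2^f) satisfies p ≥ c^y ≥ b^y, yet a positive p² - q² exceeds p.
    unbalanced : ∀ f Z y {A} → 0 ℕ.< Z → 2 ℕ.≤ y → Pos A → A ≅ 1ℤ [ + 2 ] → c ^ Z * c ^ Z - A * A ≅ + 16 [ + 32 ] →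
      sq (suc f) (c ^ Z) - sq (suc f) A ≢ b ^ y
    unbalanced f Z y {A} 0<Z 2≤y pA A≅1 e eq = ℤ.<-irrefl refl (begin-strict
      sq f (c ^ Z)                            <⟨ <-square-difference (sq-pos f (pos-^ pos-c Z)) (sq-pos f pA) (subst Pos (sym eq) (pos-^ pos-b y)) ⟩
      sq (suc f) (c ^ Z) - sq (suc f) A       ≡⟨ eq ⟩
      b ^ y                                   ≤⟨ ^-monoˡ y pos-b b≤c ⟩
      c ^ y                                   ≤⟨ ^-monoʳ pos-c y≤ ⟩
      c ^ (Z ℕ.* 2 ℕ.^ f)                     ≡⟨ sym (trans (sq-^ f (c ^ Z)) (ℤ.^-*-assoc c Z (2 ℕ.^ f))) ⟩
      sq f (c ^ Z) ∎)
      where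
      open ℤ.≤-Reasoning
      c≅1 : c ^ Z ≅ 1ℤ [ + 2 ]
      c≅1 = ≅1-^ (≅-weaken (divides (+ 4) refl) c≅1mod8) Z
      two-adic = sq-two-adic f c≅1 A≅1 e
      3y≤4+f : 3 ℕ.* y ℕ.≤ 4 ℕ.+ f
      3y≤4+f = two-adic-≤ (4 ℕ.+ f) (3 ℕ.* y) (proj₁ (proj₂ two-adic)) (trans (sym (proj₂ (proj₂ two-adic)))
        (trans eq (trans (cong (_^ y) b≡8kn) (trans (^-distrib-* (+ 8) (k * n) y) (cong (_* (k * n) ^ y) (ℤ.^-*-assoc (+ 2) 3 y))))))
      y≤f : y ℕ.≤ f
      y≤f = ℕ.+-cancelˡ-≤ 4 y f (ℕ.≤-trans (ℕ.+-monoˡ-≤ y (ℕ.*-monoʳ-≤ 2 2≤y)) (ℕ.≤-trans (ℕ.≤-reflexive (ℕ.+-comm (2 ℕ.* y) y)) 3y≤4+f))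
      y≤ : y ℕ.≤ Z ℕ.* 2 ℕ.^ f
      y≤ = ℕ.≤-trans y≤f (ℕ.≤-trans (ℕ.<⇒≤ (n<2^n f)) (ℕ.≤-trans (ℕ.≤-reflexive (sym (ℕ.*-identityˡ _))) (ℕ.*-monoˡ-≤ (2 ℕ.^ f) 0<Z)))

    odd-y-impossible : ∀ x z y → 0 ℕ.< x → 0 ℕ.< z → 1 ℕ.≤ y → a ^ (2 ℕ.* x) + b ^ suc (2 ℕ.* y) ≢ c ^ (2 ℕ.* z)
    odd-y-impossible x z y 0<x 0<z 1≤y eq = by-parity (ℕ-parity X) (ℕ-parity Z) odd∨
      where
      -- Here `x` and `z` are half the exponents, so the tower of squarings has height `suc f`.
      open TwoPart (two-part x z 0<x)
      tower : ∀ u {w W} → w ≡ W ℕ.* 2 ℕ.^ f → u ^ (2 ℕ.* w) ≡ sq (suc f) (u ^ W)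
      tower u {w} {W} e = trans (^-double u w) (cong₂ _*_ half half)
        where
        half : u ^ w ≡ sq f (u ^ W)
        half = trans (cong (u ^_) e) (trans (sym (ℤ.^-*-assoc u W (2 ℕ.^ f))) (sym (sq-^ f (u ^ W))))
      lem : ∀ p q → q ≡ p + q - p
      lem = solve-∀
      diff≡ : sq (suc f) (c ^ Z) - sq (suc f) (a ^ X) ≡ b ^ suc (2 ℕ.* y)
      diff≡ = trans (cong₂ _-_ (sym (tower c {W = Z} z≡)) (sym (tower a {W = X} x≡))) (trans (cong (_- a ^ (2 ℕ.* x)) (sym eq)) (sym (lem (a ^ (2 ℕ.* x)) (b ^ suc (2 ℕ.* y)))))
      a≅1 : a ^ X ≅ 1ℤ [ + 2 ]
      a≅1 = ≅1-^ (≅-trans (≅-weaken (divides (+ 8) refl) a≅7) (≅-by (+ 3) refl)) X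
      0<Z : 0 ℕ.< Z
      0<Z = ℕ.n≢0⇒n>0 λ Z≡0 → ℕ.<-irrefl (sym (trans z≡ (cong (ℕ._* 2 ℕ.^ f) Z≡0))) 0<z
      2≤ : 2 ℕ.≤ suc (2 ℕ.* y)
      2≤ = s≤s (ℕ.≤-trans 1≤y (ℕ.m≤m+n y _))
      impossible : n ≅ 1ℤ [ + 8 ] → ⊥
      impossible n≅1 = ≇-by (from-no (+ 16 ∣? + 9 - 1ℤ)) (≅-trans (≅-sym n²≅9) (square-mod-16 n≅1))
      by-parity : Parity X → Parity Z → (∃[ h ] X ≡ suc (2 ℕ.* h)) ⊎ (∃[ h ] Z ≡ suc (2 ℕ.* h)) → ⊥
      by-parity (ξ , inj₂ eX) (ζ , inj₂ eZ) _ = impossible (both-odd (suc f) ζ ξ y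
        (subst₂ (λ Z X → sq (suc f) (c ^ Z) - sq (suc f) (a ^ X) ≡ b ^ suc (2 ℕ.* y)) eZ eX diff≡))
      -- Modulo 32 the squares are 1 and 49 here, 81 and 1 in the next case; both differences are ≡
      -- 16.
      by-parity (ξ , inj₂ eX) (ζ , inj₁ eZ) _ = unbalanced f Z (suc (2 ℕ.* y)) 0<Z 2≤ (pos-^ pos-a X) a≅1
        (≅-trans (≅-- (square-mod-32 (subst (λ Z → c ^ Z ≅ 1ℤ [ + 16 ]) (sym eZ) (^-even-≅ c≅9 9² ζ)))
          (square-mod-32 (subst (λ X → a ^ X ≅ + 7 [ + 16 ]) (sym eX) (^-odd-≅ a≅7 7² ξ)))) (≅-by (- (+ 2)) refl)) diff≡
      by-parity (ξ , inj₁ eX) (ζ , inj₂ eZ) _ = unbalanced f Z (suc (2 ℕ.* y)) 0<Z 2≤ (pos-^ pos-a X) a≅1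
        (≅-trans (≅-- (square-mod-32 (subst (λ Z → c ^ Z ≅ + 9 [ + 16 ]) (sym eZ) (^-odd-≅ c≅9 9² ζ)))
          (square-mod-32 (subst (λ X → a ^ X ≅ 1ℤ [ + 16 ]) (sym eX) (^-even-≅ a≅7 7² ξ)))) (≅-by (+ 2) refl)) diff≡
      by-parity (ξ , inj₁ eX) (ζ , inj₁ eZ) (inj₁ (h , e)) = ℕ.even≢odd ξ h (trans (sym eX) e)
      by-parity (ξ , inj₁ eX) (ζ , inj₁ eZ) (inj₂ (h , e)) = ℕ.even≢odd ζ h (trans (sym eZ) e)

-- Two points on a conic and the factorisation they induce

pos-summand : ∀ {x y} → Pos (x * y) → Pos (x + y) → Pos x
pos-summand {+ suc x} {y} _ _ = +<+ (s≤s z≤n)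
pos-summand {+ 0} {y} (+<+ ()) _
pos-summand { -[1+ x ]} {+ 0} p _ = contradiction (subst Pos (ℤ.*-zeroʳ -[1+ x ]) p) λ { (+<+ ()) }
pos-summand { -[1+ x ]} {+ suc y} () _
pos-summand { -[1+ x ]} { -[1+ y ]} _ ()

-- The points (1 : w : 1) and (U : A : B) of the conic cX² = Y² + bZ². The values
-- L₁, L₂, L₂′ of the bilinear form (up to signs of coordinates) satisfy
-- L₁L₂ = bcH² and L₁L₂′ = bV². As gcd(L₂, L₂′) = 2t with t ∣ K, this gives
-- (L₁/4) t = K gcd(cH², V²), and gcd(cH², V²) is a square times a divisor of c.
module Conic (b c w U A B K : ℤ)
  (c≡ : c ≡ w * w + b) (point : A * A + b * (B * B) ≡ c * (U * U)) (b≡8K : b ≡ + 8 * K)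
  (pos-K : Pos K) (pos-c : Pos c) (pos-U : Pos U) (pos-B : Pos B)
  (H⊥b : Cop (B + U) b) (c⊥b : Cop c b) (odd-H : Cop (+ 2) (B + U)) (B-radical : ∀ {x} → Cop x b → Cop x B)
  (c-divisors : ∀ {d} → Pos d → d ∣ c → d ≅ 1ℤ [ + 4 ])
  (P Q : ℤ) (L₁≡ : c * U + w * A + b * B ≡ + 4 * P) (L₂≡ : c * U - w * A + b * B ≡ + 2 * Q) where

  H V Q′ : ℤ
  H = B + U
  V = w * B - A
  Q′ = Q - b * B

  pos-b : Pos b
  pos-b = subst Pos (sym b≡8K) (pos-* {+ 8} (+<+ (s≤s z≤n)) pos-K)

  pos-H : Pos H
  pos-H = pos-+ pos-B pos-U

  w²≡ : w * w ≡ c - b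
  w²≡ = trans (lem (w * w) b) (cong (_- b) (sym c≡))
    where
    lem : ∀ x b → x ≡ x + b - b
    lem = solve-∀

  A²≡ : A * A ≡ c * (U * U) - b * (B * B)
  A²≡ = trans (lem (A * A) (b * (B * B))) (cong (_- b * (B * B)) point)
    where
    lem : ∀ x b → x ≡ x + b - b
    lem = solve-∀

  L₂′≡ : c * U - w * A - b * B ≡ + 2 * Q′
  L₂′≡ = trans (lem₁ (c * U - w * A) (b * B)) (trans (cong (_- + 2 * (b * B)) L₂≡) (lem₂ Q (b * B)))
    where
    lem₁ : ∀ x y → x - y ≡ x + y - + 2 * y
    lem₁ = solve-∀
    lem₂ : ∀ Q y → + 2 * Q - + 2 * y ≡ + 2 * (Q - y)
    lem₂ = solve-∀

  L₁L₂≡ : (c * U + w * A + b * B) * (c * U - w * A + b * B) ≡ b * (c * (H * H))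
  L₁L₂≡ = trans (lem₁ b c w U A B) (trans (cong₂ (λ x y → (c * U + b * B) * (c * U + b * B) - x * y) w²≡ A²≡) (lem₂ b c U B))
    where
    lem₁ : ∀ b c w U A B → (c * U + w * A + b * B) * (c * U - w * A + b * B) ≡ (c * U + b * B) * (c * U + b * B) - w * w * (A * A)
    lem₁ = solve-∀
    lem₂ : ∀ b c U B → (c * U + b * B) * (c * U + b * B) - (c - b) * (c * (U * U) - b * (B * B)) ≡ b * (c * ((B + U) * (B + U)))
    lem₂ = solve-∀

  L₁L₂′≡ : (c * U + w * A + b * B) * (c * U - w * A - b * B) ≡ b * (V * V)
  L₁L₂′≡ = trans (lem₁ b c w U A B) (trans (cong₂ (λ x y → c * U * (c * U) - (x * y + + 2 * (w * A * (b * B)) + b * B * (b * B))) w²≡ A²≡)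
    (trans (lem₂ b c U B (w * A)) (trans (cong₂ (λ x y → b * (x * (B * B) - + 2 * (w * A * B) + y)) (sym w²≡) (sym A²≡)) (lem₃ b w A B))))
    where
    lem₁ : ∀ b c w U A B → (c * U + w * A + b * B) * (c * U - w * A - b * B) ≡ c * U * (c * U) - (w * w * (A * A) + + 2 * (w * A * (b * B)) + b * B * (b * B))
    lem₁ = solve-∀
    lem₂ : ∀ b c U B z → c * U * (c * U) - ((c - b) * (c * (U * U) - b * (B * B)) + + 2 * (z * (b * B)) + b * B * (b * B)) ≡
      b * ((c - b) * (B * B) - + 2 * (z * B) + (c * (U * U) - b * (B * B)))
    lem₂ = solve-∀
    lem₃ : ∀ b w A B → b * (w * w * (B * B) - + 2 * (w * A * B) + A * A) ≡ b * ((w * B - A) * (w * B - A))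
    lem₃ = solve-∀

  cancel-8 : ∀ {P Q x} → + 4 * P * (+ 2 * Q) ≡ b * x → P * Q ≡ K * x
  cancel-8 {P} {Q} {x} e = *-cancelˡ (+ 8) (+<+ (s≤s z≤n)) (trans (sym (lem P Q)) (trans e (trans (cong (_* x) b≡8K) (ℤ.*-assoc (+ 8) K x))))
    where
    lem : ∀ P Q → + 4 * P * (+ 2 * Q) ≡ + 8 * (P * Q)
    lem = solve-∀

  PQ≡ : P * Q ≡ K * (c * (H * H))
  PQ≡ = cancel-8 {P} {Q} (trans (sym (cong₂ _*_ L₁≡ L₂≡)) L₁L₂≡)

  PQ′≡ : P * Q′ ≡ K * (V * V)
  PQ′≡ = cancel-8 {P} {Q′} (trans (sym (cong₂ _*_ L₁≡ L₂′≡)) L₁L₂′≡)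

  -- L₁ and L₂ have a positive product and the positive sum 2(cU + bB).
  pos-P : Pos P
  pos-P = pos-*-cancelˡ {+ 4} (+<+ (s≤s z≤n)) (subst Pos L₁≡ (pos-summand
    (subst Pos (sym L₁L₂≡) (pos-* pos-b (pos-* pos-c (pos-* pos-H pos-H))))
    (subst Pos (lem (c * U) (w * A) (b * B)) (pos-* {+ 2} (+<+ (s≤s z≤n)) (pos-+ (pos-* pos-c pos-U) (pos-* pos-b pos-B))))))
    where
    lem : ∀ x y z → + 2 * (x + z) ≡ x + y + z + (x - y + z)
    lem = solve-∀

  open GCD (gcd H V pos-H) public renaming (g to F; a′ to h; b′ to v; pos to pos-F; eqˡ to H≡; eqʳ to V≡; coprime to h⊥v)

  pos-h : Pos h
  pos-h = pos-*-cancelˡ pos-F (subst Pos H≡ pos-H)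

  open GCD (gcd (c * (h * h)) (v * v) (pos-* pos-c (pos-* pos-h pos-h))) public
    renaming (g to e; a′ to α; b′ to β; pos to pos-e; eqˡ to ch²≡; eqʳ to v²≡; coprime to α⊥β)

  -- This is gcd(cH², V²), taken in two stages so that the square F² and the remaining factor e stay
  -- visible; α and β are its coprime cofactors.
  g : ℤ
  g = F * F * e

  gα≡ : g * α ≡ c * (H * H)
  gα≡ = trans (lem₁ F e α) (trans (cong (F * F *_) (sym ch²≡)) (trans (lem₂ F c h) (cong (c *_) (cong₂ _*_ (sym H≡) (sym H≡)))))
    where
    lem₁ : ∀ F e α → F * F * e * α ≡ F * F * (e * α)
    lem₁ = solve-∀
    lem₂ : ∀ F c h → F * F * (c * (h * h)) ≡ c * (F * h * (F * h))
    lem₂ = solve-∀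

  gβ≡ : g * β ≡ V * V
  gβ≡ = trans (lem₁ F e β) (trans (cong (F * F *_) (sym v²≡)) (trans (lem₂ F v) (cong₂ _*_ (sym V≡) (sym V≡))))
    where
    lem₁ : ∀ F e α → F * F * e * α ≡ F * F * (e * α)
    lem₁ = solve-∀
    lem₂ : ∀ F h → F * F * (h * h) ≡ F * h * (F * h)
    lem₂ = solve-∀

  pos-g : Pos g
  pos-g = pos-* (pos-* pos-F pos-F) pos-e

  -- e divides v², which is coprime to h, and it divides ch².
  e∣c : e ∣ c
  e∣c = cop-∣-* {e} {h * h} {c} (cop-∣ (divides β (trans v²≡ (ℤ.*-comm e β))) (cop-sym (cop-* (cop-sym v²⊥h) (cop-sym v²⊥h))))
    (divides α (trans (ℤ.*-comm (h * h) c) (trans ch²≡ (ℤ.*-comm e α))))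
    where
    v²⊥h : Cop (v * v) h
    v²⊥h = cop-* (cop-sym h⊥v) (cop-sym h⊥v)

  g≅1 : g ≅ 1ℤ [ + 4 ]
  g≅1 = ≅-* (≅-weaken (divides (+ 2) refl) (odd-square (odd⇒≅1 (pos⇒odd pos-F (cop-sym (cop-∣ (divides h (trans H≡ (ℤ.*-comm F h))) (cop-sym odd-H)))))))
    (c-divisors pos-e e∣c)

  g⊥b : Cop g b
  g⊥b = cop-∣ (divides α (trans (sym gα≡) (ℤ.*-comm g α))) (cop-* c⊥b (cop-* H⊥b H⊥b))

  -- Since PQ = Kgα and PQ′ = Kgβ with α and β coprime, their Bézout coefficients make this
  -- combination gcd(Q, Q′), and Pt = Kg.
  t : ℤ
  t = Cop.u α⊥β * Q + Cop.v α⊥β * Q′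

  Pt≡ : P * t ≡ K * g
  Pt≡ = begin
    P * (u * Q + v′ * Q′)               ≡⟨ lem₁ P u Q v′ Q′ ⟩
    u * (P * Q) + v′ * (P * Q′)         ≡⟨ cong₂ (λ x y → u * x + v′ * y) (trans PQ≡ (cong (K *_) (sym gα≡))) (trans PQ′≡ (cong (K *_) (sym gβ≡))) ⟩
    u * (K * (g * α)) + v′ * (K * (g * β)) ≡⟨ lem₂ K g α β u v′ ⟩
    K * g * (u * α + v′ * β)            ≡⟨ cong (K * g *_) (Cop.bézout α⊥β) ⟩
    K * g * 1ℤ                          ≡⟨ ℤ.*-identityʳ (K * g) ⟩
    K * g ∎
    where
    open ≡-Reasoning
    u = Cop.u α⊥β
    v′ = Cop.v α⊥β
    lem₁ : ∀ P u Q v Q′ → P * (u * Q + v * Q′) ≡ u * (P * Q) + v * (P * Q′)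
    lem₁ = solve-∀
    lem₂ : ∀ K g α β u v → u * (K * (g * α)) + v * (K * (g * β)) ≡ K * g * (u * α + v * β)
    lem₂ = solve-∀

  pos-t : Pos t
  pos-t = pos-*-cancelˡ pos-P (subst Pos (sym Pt≡) (pos-* pos-K pos-g))

  t∣Q : t ∣ Q
  t∣Q = divides α (*-cancelˡ P pos-P (trans PQ≡ (trans (cong (K *_) (sym gα≡)) (trans (sym (ℤ.*-assoc K g α)) (trans (cong (_* α) (sym Pt≡)) (lem P t α))))))
    where
    lem : ∀ P t α → P * t * α ≡ P * (α * t)
    lem = solve-∀

  t∣Q′ : t ∣ Q′
  t∣Q′ = divides β (*-cancelˡ P pos-P (trans PQ′≡ (trans (cong (K *_) (sym gβ≡)) (trans (sym (ℤ.*-assoc K g β)) (trans (cong (_* β) (sym Pt≡)) (lem P t β))))))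
    where
    lem : ∀ P t α → P * t * α ≡ P * (α * t)
    lem = solve-∀

  t∣bB : t ∣ b * B
  t∣bB = ∣-lin 1ℤ -1ℤ t∣Q t∣Q′ (lem Q (b * B))
    where
    lem : ∀ Q x → x ≡ 1ℤ * Q + -1ℤ * (Q - x)
    lem = solve-∀

  -- t divides Q - Q′ = bB, which is coprime to g, and t divides Kg = Pt.
  t∣K : t ∣ K
  t∣K = cop-∣-* (cop-∣ t∣bB (cop-sym g⊥bB)) (divides P (trans (ℤ.*-comm g K) (sym Pt≡)))
    where
    g⊥bB : Cop g (b * B)
    g⊥bB = cop-sym (cop-* (cop-sym g⊥b) (cop-sym (B-radical g⊥b)))

  s : ℤ
  s = _∣_.quotient t∣K

  K≡st : K ≡ s * t
  K≡st = _∣_.equality t∣K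

  pos-s : Pos s
  pos-s = pos-*-cancelˡ pos-t (subst Pos (trans K≡st (ℤ.*-comm s t)) pos-K)

  P≡sg : P ≡ s * g
  P≡sg = *-cancelˡ t pos-t (trans (ℤ.*-comm t P) (trans Pt≡ (trans (cong (_* g) K≡st) (lem s t g))))
    where
    lem : ∀ s t g → s * t * g ≡ t * (s * g)
    lem = solve-∀

  s≅P : s ≅ P [ + 4 ]
  s≅P = ≅-sym (≅-trans (≅-reflexive P≡sg) (≅-trans (≅-* (≅-refl {s}) g≅1) (≅-reflexive (ℤ.*-identityʳ s))))

  -- The purpose of the construction: cU ≡ -wA modulo s and, by the companion below, cU ≡ wA modulo
  -- t. These become the residue conditions on the factors of k and n.
  s∣ : s ∣ c * U + w * A
  s∣ = ∣-lin (+ 4 * g) (- (+ 8 * t * B)) (∣-refl {s}) (∣-refl {s}) (begin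
    c * U + w * A                          ≡⟨ lem₁ (c * U + w * A) (b * B) ⟩
    c * U + w * A + b * B - b * B          ≡⟨ cong₂ (λ x y → x - y * B) (trans L₁≡ (cong (+ 4 *_) P≡sg)) (trans b≡8K (cong (+ 8 *_) K≡st)) ⟩
    + 4 * (s * g) - + 8 * (s * t) * B      ≡⟨ lem₂ s g t B ⟩
    + 4 * g * s + - (+ 8 * t * B) * s ∎)
    where
    open ≡-Reasoning
    lem₁ : ∀ x y → x ≡ x + y - y
    lem₁ = solve-∀
    lem₂ : ∀ s g t B → + 4 * (s * g) - + 8 * (s * t) * B ≡ + 4 * g * s + - (+ 8 * t * B) * s
    lem₂ = solve-∀

  t∣ : t ∣ c * U - w * A
  t∣ = ∣-lin 1ℤ 1ℤ t∣Q t∣Q′ (*-cancelˡ (+ 2) (+<+ (s≤s z≤n)) (trans (lem₁ (c * U - w * A) (b * B)) (trans (cong₂ _+_ L₂≡ L₂′≡) (lem₂ Q Q′))))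
    where
    lem₁ : ∀ x y → + 2 * x ≡ x + y + (x - y)
    lem₁ = solve-∀
    lem₂ : ∀ x y → + 2 * x + + 2 * y ≡ + 2 * (1ℤ * x + 1ℤ * y)
    lem₂ = solve-∀

-- Reciprocity along factorisations of k and n

jacobi-sign : ∀ s h → jacobi ⟪ s ⟫ h ≡ sign^ s h
jacobi-sign Sign.+ h = trans (jacobi-1 h) (sym (sign^-+ h))
jacobi-sign Sign.- h = trans (jacobi--1 h) (sym (sign^-- h))

cop-sign : ∀ s {N} → Cop ⟪ s ⟫ N
cop-sign Sign.+ = cop-1ˡ
cop-sign Sign.- = cop--1

jacobi-signed : ∀ s {x} h → Cop x (odd h) → jacobi (⟪ s ⟫ * x) h ≡ Sign.+ → jacobi x h ≡ sign^ s h
jacobi-signed s {x} h c e = trans (sym (*≡+⇒≡ _ _ (trans (sym (jacobi-* {h = h} (cop-sign s) c)) e))) (jacobi-sign s h)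

-- Multiplying the symbols along the two factorisations, (n/k) = (−1/τ) and (k/n) = (−1/sₙ).
reciprocity-mod-4 : ∀ {k n τ sₖ tₙ sₙ} δ → Odd k → Odd n → Odd τ → Odd sₖ → Odd tₙ → Odd sₙ → Cop k n →
  k ≡ τ * sₖ → n ≡ sₙ * tₙ → n ≅ 1ℤ [ + 4 ] →
  (∀ {h} → τ ≡ odd h → jacobi (-1ℤ * n) h ≡ Sign.+) →
  (∀ {h} → sₖ ≡ odd h → jacobi n h ≡ Sign.+) →
  (∀ {h} → tₙ ≡ odd h → jacobi (⟪ δ ⟫ * k) h ≡ Sign.+) →
  (∀ {h} → sₙ ≡ odd h → jacobi (⟪ opposite δ ⟫ * k) h ≡ Sign.+) →
  τ ≅ sₙ [ + 4 ]
reciprocity-mod-4 δ (hk , refl) (hn , refl) (hτ , refl) (hsk , refl) (htn , refl) (hsn , refl) k⊥n k≡ n≡ n≅1 jτ jsk jtn jsn =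
  ≅-trans (odd-mod-4 hτ) (≅-trans (≅-reflexive (cong ⟪_⟫ parities)) (≅-sym (odd-mod-4 hsn)))
  where
  open ≡-Reasoning
  τ∣k : odd hτ ∣ odd hk
  τ∣k = divides (odd hsk) (trans k≡ (ℤ.*-comm (odd hτ) (odd hsk)))
  sk∣k : odd hsk ∣ odd hk
  sk∣k = divides (odd hτ) k≡
  sn∣n : odd hsn ∣ odd hn
  sn∣n = divides (odd htn) (trans n≡ (ℤ.*-comm (odd hsn) (odd htn)))
  tn∣n : odd htn ∣ odd hn
  tn∣n = divides (odd hsn) n≡
  n⊥τ : Cop (odd hn) (odd hτ)
  n⊥τ = cop-sym (cop-∣ τ∣k k⊥n)
  n⊥sk : Cop (odd hn) (odd hsk)
  n⊥sk = cop-sym (cop-∣ sk∣k k⊥n)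
  k⊥sn : Cop (odd hk) (odd hsn)
  k⊥sn = cop-sym (cop-∣ sn∣n (cop-sym k⊥n))
  k⊥tn : Cop (odd hk) (odd htn)
  k⊥tn = cop-sym (cop-∣ tn∣n (cop-sym k⊥n))
  parity-n : parity hn ≡ Sign.+
  parity-n = parity-mod-4 hn Sign.+ n≅1
  parity-sn-tn : parity hsn Sign.* parity htn ≡ Sign.+
  parity-sn-tn = ⟪⟫-injective _ _ (≅-trans (≅-reflexive (⟪⟫-* (parity hsn) (parity htn)))
    (≅-trans (≅-* (≅-sym (odd-mod-4 hsn)) (≅-sym (odd-mod-4 htn))) (≅-trans (≅-reflexive (sym n≡)) n≅1)))
  -- δ drops out: sₙtₙ = n ≡ 1 (mod 4) forces sₙ ≡ tₙ (mod 4).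
  final : ∀ δ → parity hsn Sign.* parity htn ≡ Sign.+ → sign^ (opposite δ) hsn Sign.* sign^ δ htn ≡ parity hsn
  final Sign.+ _ = trans (cong₂ Sign._*_ (sign^-- hsn) (sign^-+ htn)) (Sign.*-identityʳ (parity hsn))
  final Sign.- e = trans (cong₂ Sign._*_ (sign^-+ hsn) (sign^-- htn)) (sym (*≡+⇒≡ _ _ e))
  parities : parity hτ ≡ parity hsn
  parities = begin
    parity hτ                                              ≡⟨ sym (sign^-- hτ) ⟩
    sign^ Sign.- hτ                                        ≡⟨ sym (jacobi-signed Sign.- hτ n⊥τ (jτ refl)) ⟩
    jacobi (odd hn) hτ                                     ≡⟨ sym (Sign.*-identityʳ _) ⟩
    jacobi (odd hn) hτ Sign.* Sign.+                       ≡⟨ cong (jacobi (odd hn) hτ Sign.*_) (sym (jsk refl)) ⟩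
    jacobi (odd hn) hτ Sign.* jacobi (odd hn) hsk          ≡⟨ sym (jacobi-bottom hn hk hτ hsk k≡ n⊥τ n⊥sk) ⟩
    jacobi (odd hn) hk                                     ≡⟨ sym (jacobi-flip hn hk k⊥n parity-n) ⟩
    jacobi (odd hk) hn                                     ≡⟨ jacobi-bottom hk hn hsn htn n≡ k⊥sn k⊥tn ⟩
    jacobi (odd hk) hsn Sign.* jacobi (odd hk) htn         ≡⟨ cong₂ Sign._*_ (jacobi-signed (opposite δ) hsn k⊥sn (jsn refl)) (jacobi-signed δ htn k⊥tn (jtn refl)) ⟩
    sign^ (opposite δ) hsn Sign.* sign^ δ htn              ≡⟨ final δ parity-sn-tn ⟩
    parity hsn ∎

-- Case n ≡ 9 (mod 16): odd y and z are impossible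

module OddExponents (m n k : ℤ) (m≡ : m ≡ + 4 * k) (odd-k : Odd k) (odd-n : Odd n) (m⊥n : Cop m n)
  (a b c : ℤ) (a≡ : a ≡ m * m - n * n) (b≡ : b ≡ + 2 * m * n) (c≡ : c ≡ m * m + n * n) (n≅9 : n ≅ + 9 [ + 16 ])
  (X r q : ℕ) (eq : a ^ (2 ℕ.* X) + b ^ suc (2 ℕ.* suc q) ≡ c ^ suc (2 ℕ.* r)) where

  open Triple m n k m≡ odd-k odd-n m⊥n a b c a≡ b≡ c≡

  w U A B K : ℤ
  w = m - n
  U = c ^ r
  -- The conic fixes A only up to sign. This choice gives A ≡ 1 (mod 16), as -a = n² - m², and so
  -- determines L₁ modulo 16.
  A = (- a) ^ X
  B = b ^ suc q
  K = k * n

  c≡w²+b : c ≡ w * w + b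
  c≡w²+b = trans c≡ (trans (lem m n) (cong (_+_ (w * w)) (sym b≡)))
    where
    lem : ∀ m n → m * m + n * n ≡ (m - n) * (m - n) + + 2 * m * n
    lem = solve-∀

  A²≡ : A * A ≡ a ^ (2 ℕ.* X)
  A²≡ = trans (sym (^-distrib-* (- a) (- a) X)) (trans (cong (_^ X) (lem a)) (trans (^-distrib-* a a X) (sym (^-double a X))))
    where
    lem : ∀ u → - u * - u ≡ u * u
    lem = solve-∀

  point : A * A + b * (B * B) ≡ c * (U * U)
  point = trans (cong₂ _+_ A²≡ (sym (^-suc-double b (suc q)))) (trans eq (^-suc-double c r))

  U⊥b : Cop U b
  U⊥b = cop-^ r c⊥b

  H⊥b : Cop (B + U) b
  H⊥b = cop-≅ (≅-trans (≅-+ (∣⇒≅0 (∣-*ˡ (b ^ q))) (≅-refl {U})) (≅-reflexive (ℤ.+-identityˡ U))) U⊥b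

  2∣b : + 2 ∣ b
  2∣b = divides (+ 4 * K) (trans b≡8kn (lem K))
    where
    lem : ∀ K → + 8 * K ≡ + 4 * K * + 2
    lem = solve-∀

  c-divisors : ∀ {d} → Pos d → d ∣ c → d ≅ 1ℤ [ + 4 ]
  c-divisors {d} pos-d d∣c = sum-of-squares {d} {m} {n} (pos⇒odd pos-d (cop-sym (cop-∣ d∣c (cop-sym 2⊥c)))) (cop-sym (cop-∣ d∣c c⊥n)) (subst (d ∣_) c≡ d∣c)

  n²≅1 : n * n ≅ 1ℤ [ + 16 ]
  n²≅1 = ≅-trans (≅-* n≅9 n≅9) (≅-by (+ 5) refl)

  c≅1 : c ≅ 1ℤ [ + 16 ]
  c≅1 = ≅-trans (≅-reflexive c≡) (≅-+ m²≅0 n²≅1)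

  -a≅1 : - a ≅ 1ℤ [ + 16 ]
  -a≅1 = ≅-trans (≅-reflexive (trans (cong -_ a≡) (lem m n))) (≅-- n²≅1 m²≅0)
    where
    lem : ∀ m n → - (m * m - n * n) ≡ n * n - m * m
    lem = solve-∀

  bB≅0 : b * B ≅ 0ℤ [ + 16 ]
  bB≅0 = ∣⇒≅0 (divides (+ 4 * (K * K) * b ^ q) (trans (cong₂ (λ x y → x * (y * b ^ q)) b≡8kn b≡8kn) (lem K (b ^ q))))
    where
    lem : ∀ K z → + 8 * K * (+ 8 * K * z) ≡ + 4 * (K * K) * z * + 16
    lem = solve-∀

  cU≅1 : c * U ≅ 1ℤ [ + 16 ]
  cU≅1 = ≅-* c≅1 (≅1-^ c≅1 r)

  wA≅ : w * A ≅ + 4 * k - + 9 [ + 16 ]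
  wA≅ = ≅-trans (≅-* (≅-- (≅-reflexive m≡) n≅9) (≅1-^ -a≅1 X)) (≅-reflexive (ℤ.*-identityʳ (+ 4 * k - + 9)))

  L₁≅ : c * U + w * A + b * B ≅ 1ℤ + (+ 4 * k - + 9) + 0ℤ [ + 16 ]
  L₁≅ = ≅-+ (≅-+ cU≅1 wA≅) bB≅0

  L₂≅ : c * U - w * A + b * B ≅ 1ℤ - (+ 4 * k - + 9) + 0ℤ [ + 16 ]
  L₂≅ = ≅-+ (≅-- cU≅1 wA≅) bB≅0

  P Q : ℤ
  -- From 1 + (4k - 9) + 16u = 4(k - 2 + 4u). Only P ≡ k - 2 (mod 4) matters in the end.
  P = k - + 2 + proj₁ (≅-expand L₁≅) * + 4
  Q = + 5 - + 2 * k + + 8 * proj₁ (≅-expand L₂≅)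

  L₁≡ : c * U + w * A + b * B ≡ + 4 * P
  L₁≡ = trans (proj₂ (≅-expand L₁≅)) (lem k (proj₁ (≅-expand L₁≅)))
    where
    lem : ∀ k u → 1ℤ + (+ 4 * k - + 9) + 0ℤ + u * + 16 ≡ + 4 * (k - + 2 + u * + 4)
    lem = solve-∀

  L₂≡ : c * U - w * A + b * B ≡ + 2 * Q
  L₂≡ = trans (proj₂ (≅-expand L₂≅)) (lem k (proj₁ (≅-expand L₂≅)))
    where
    lem : ∀ k u → 1ℤ - (+ 4 * k - + 9) + 0ℤ + u * + 16 ≡ + 2 * (+ 5 - + 2 * k + + 8 * u)
    lem = solve-∀

  open Conic b c w U A B K c≡w²+b point b≡8kn (pos-* (odd⇒pos odd-k) pos-n) pos-c (pos-^ pos-c r) (pos-^ pos-b (suc q))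
    H⊥b c⊥b (cop-sym (cop-sym (cop-∣ 2∣b (cop-sym H⊥b)))) (λ x⊥b → cop-sym (cop-^ (suc q) (cop-sym x⊥b))) c-divisors P Q L₁≡ L₂≡
    using (s; t; pos-s; pos-t; K≡st; s≅P; s∣; t∣)

  -- τ = gcd(t, k) gives a common refinement of st = kn: t = τtₙ, k = τsₖ, n = sₙtₙ, s = sₖsₙ.
  open GCD (gcd t k pos-t) using () renaming (g to τ; a′ to tₙ; b′ to sₖ; pos to pos-τ; eqˡ to t≡; eqʳ to k≡; coprime to tₙ⊥sₖ)

  stₙ≡ : s * tₙ ≡ sₖ * n
  stₙ≡ = *-cancelˡ τ pos-τ (trans (lem τ s tₙ) (trans (cong (s *_) (sym t≡)) (trans (sym K≡st) (trans (cong (_* n) k≡) (ℤ.*-assoc τ sₖ n)))))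
    where
    lem : ∀ x s y → x * (s * y) ≡ s * (x * y)
    lem = solve-∀

  tₙ∣n : tₙ ∣ n
  tₙ∣n = cop-∣-* tₙ⊥sₖ (divides s (sym stₙ≡))

  sₙ : ℤ
  sₙ = _∣_.quotient tₙ∣n

  n≡ : n ≡ sₙ * tₙ
  n≡ = _∣_.equality tₙ∣n

  pos-tₙ : Pos tₙ
  pos-tₙ = pos-*-cancelˡ pos-τ (subst Pos t≡ pos-t)

  s≡ : s ≡ sₖ * sₙ
  s≡ = *-cancelˡ tₙ pos-tₙ (trans (ℤ.*-comm tₙ s) (trans stₙ≡ (trans (cong (sₖ *_) n≡) (lem sₖ sₙ tₙ))))
    where
    lem : ∀ x y z → x * (y * z) ≡ z * (x * y)
    lem = solve-∀

  τ∣k : τ ∣ k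
  τ∣k = divides sₖ (trans k≡ (ℤ.*-comm τ sₖ))

  sₖ∣k : sₖ ∣ k
  sₖ∣k = divides τ k≡

  sₙ∣n : sₙ ∣ n
  sₙ∣n = divides tₙ (trans n≡ (ℤ.*-comm sₙ tₙ))

  odd-τ : Odd τ
  odd-τ = odd-∣ pos-τ τ∣k odd-k

  odd-sₖ : Odd sₖ
  odd-sₖ = odd-∣ (pos-*-cancelˡ pos-τ (subst Pos k≡ (odd⇒pos odd-k))) sₖ∣k odd-k

  odd-tₙ : Odd tₙ
  odd-tₙ = odd-∣ pos-tₙ tₙ∣n odd-n

  odd-sₙ : Odd sₙ
  odd-sₙ = odd-∣ (pos-*-cancelˡ pos-tₙ (subst Pos (trans n≡ (ℤ.*-comm sₙ tₙ)) pos-n)) sₙ∣n odd-n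

  k∣m : k ∣ m
  k∣m = divides (+ 4) m≡

  k⊥n : Cop k n
  k⊥n = cop-∣ k∣m m⊥n

  δ : Sign
  δ = parity X

  sign-^ : ∀ j → (-1ℤ) ^ j ≡ ⟪ parity j ⟫
  sign-^ zero    = refl
  sign-^ (suc j) = trans (cong (-1ℤ *_) (sign-^ j)) (sym (⟪⟫-* Sign.- (parity j)))

  -- cU is c^(r+1), and c is itself a square modulo m and modulo n, namely n² and m².
  cU-mod-m : ∀ {N} → N ∣ m → c * U ≅ (n * n ^ r) * (n * n ^ r) [ N ]
  cU-mod-m N∣m = ≅-trans (≅-* (c≅n² N∣m) (≅-^ (c≅n² N∣m) r)) (≅-reflexive (trans (cong (n * n *_) (^-distrib-* n n r)) (lem n (n ^ r))))
    where
    lem : ∀ n z → n * n * (z * z) ≡ n * z * (n * z)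
    lem = solve-∀

  cU-mod-n : ∀ {N} → N ∣ n → c * U ≅ (m * m ^ r) * (m * m ^ r) [ N ]
  cU-mod-n N∣n = ≅-trans (≅-* (c≅m² N∣n) (≅-^ (c≅m² N∣n) r)) (≅-reflexive (trans (cong (m * m *_) (^-distrib-* m m r)) (lem m (m ^ r))))
    where
    lem : ∀ n z → n * n * (z * z) ≡ n * z * (n * z)
    lem = solve-∀

  -- Modulo m, w ≡ -n and -a ≡ n², so wA has the square class of -n. Modulo n, w ≡ 4k and -a ≡ -m²,
  -- which leaves (-1)^X k, the 4 being absorbed into the square.
  wA-mod-m : ∀ {N} → N ∣ m → w * A ≅ -1ℤ * n * (n ^ X * n ^ X) [ N ]
  wA-mod-m N∣m = ≅-* (≅-trans (≅-- (∣⇒≅0 N∣m) (≅-refl {n})) (≅-reflexive (lem n)))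
    (≅-trans (≅-^ (≅-trans (≅-trans (≅-reflexive (sym (ℤ.+-identityˡ (- a)))) (≅-- (≅-refl {0ℤ}) (a≅-n² N∣m))) (≅-reflexive (lem′ (n * n)))) X) (≅-reflexive (^-distrib-* n n X)))
    where
    lem : ∀ n → 0ℤ - n ≡ -1ℤ * n
    lem = solve-∀
    lem′ : ∀ n → 0ℤ - (- n) ≡ n
    lem′ = solve-∀

  wA-mod-n : ∀ {N} → N ∣ n → w * A ≅ ⟪ δ ⟫ * k * (+ 2 * m ^ X * (+ 2 * m ^ X)) [ N ]
  wA-mod-n N∣n = ≅-trans (≅-* (≅-trans (≅-- (≅-refl {m}) (∣⇒≅0 N∣n)) (≅-reflexive (trans (ℤ.+-identityʳ m) m≡)))
    (≅-trans (≅-^ (≅-trans (≅-trans (≅-reflexive (sym (ℤ.+-identityˡ (- a)))) (≅-- (≅-refl {0ℤ}) (a≅m² N∣n))) (≅-reflexive (lem′ (m * m)))) X)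
      (≅-reflexive (trans (^-distrib-* -1ℤ (m * m) X) (cong₂ _*_ (sign-^ X) (^-distrib-* m m X))))))
    (≅-reflexive (lem ⟪ δ ⟫ k (m ^ X)))
    where
    lem : ∀ δ k z → + 4 * k * (δ * (z * z)) ≡ δ * k * (+ 2 * z * (+ 2 * z))
    lem = solve-∀
    lem′ : ∀ n → 0ℤ - n ≡ -1ℤ * n
    lem′ = solve-∀

  ≅-from-sum : ∀ {x y N} → N ∣ x + y → x ≅ - y [ N ]
  ≅-from-sum {x} {y} d = mod (∣-mul 1ℤ d (lem x y))
    where
    lem : ∀ x y → x - - y ≡ 1ℤ * (x + y)
    lem = solve-∀

  n⊥ : ∀ {N} → N ∣ k → Cop n N
  n⊥ N∣k = cop-sym (cop-∣ N∣k k⊥n)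

  2m^X⊥ : ∀ {N} → Odd N → N ∣ n → Cop (+ 2 * m ^ X) N
  2m^X⊥ o N∣n = cop-* (cop-2 o) (cop-^ X (cop-sym (cop-∣ N∣n (cop-sym m⊥n))))

  k⊥ : ∀ {N} → N ∣ n → Cop k N
  k⊥ N∣n = cop-sym (cop-∣ N∣n (cop-sym k⊥n))

  -- The square cU is wA on divisors of t and -wA on divisors of s. So -n, n, δk, -δk are residues
  -- modulo τ, sₖ, tₙ, sₙ respectively.
  on-τ : ∀ {h} → τ ≡ odd h → jacobi (-1ℤ * n) h ≡ Sign.+
  on-τ {h} e = jacobi-residue {u = n * n ^ r} {n ^ X} h (cop-* cop--1 (n⊥ d)) (cop-^ X (n⊥ d))
    (≅-trans (≅-sym (cU-mod-m d′)) (≅-trans (mod (∣-trans (divides tₙ (trans t≡ (trans (ℤ.*-comm τ tₙ) (cong (tₙ *_) e)))) t∣)) (wA-mod-m d′)))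
    where
    d = subst (_∣ k) e τ∣k
    d′ = ∣-trans d k∣m

  on-sₖ : ∀ {h} → sₖ ≡ odd h → jacobi n h ≡ Sign.+
  on-sₖ {h} e = jacobi-residue {u = n * n ^ r} {n ^ X} h (n⊥ d) (cop-^ X (n⊥ d))
    (≅-trans (≅-sym (cU-mod-m d′)) (≅-trans (≅-from-sum (∣-trans (divides sₙ (trans s≡ (trans (ℤ.*-comm sₖ sₙ) (cong (sₙ *_) e)))) s∣))
      (≅-trans (≅-trans (≅-reflexive (sym (ℤ.+-identityˡ (- (w * A))))) (≅-- (≅-refl {0ℤ}) (wA-mod-m d′))) (≅-reflexive (lem n (n ^ X * n ^ X))))))
    where
    d = subst (_∣ k) e sₖ∣k
    d′ = ∣-trans d k∣m
    lem : ∀ n z → 0ℤ - -1ℤ * n * z ≡ n * z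
    lem = solve-∀

  on-tₙ : ∀ {h} → tₙ ≡ odd h → jacobi (⟪ δ ⟫ * k) h ≡ Sign.+
  on-tₙ {h} e = jacobi-residue {u = m * m ^ r} {+ 2 * m ^ X} h (cop-* (cop-sign δ) (k⊥ d)) (2m^X⊥ (h , refl) d)
    (≅-trans (≅-sym (cU-mod-n d)) (≅-trans (mod (∣-trans (divides τ (trans t≡ (cong (τ *_) e))) t∣)) (wA-mod-n d)))
    where
    d = subst (_∣ n) e tₙ∣n

  on-sₙ : ∀ {h} → sₙ ≡ odd h → jacobi (⟪ opposite δ ⟫ * k) h ≡ Sign.+
  on-sₙ {h} e = jacobi-residue {u = m * m ^ r} {+ 2 * m ^ X} h (cop-* (cop-sign (opposite δ)) (k⊥ d)) (2m^X⊥ (h , refl) d)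
    (≅-trans (≅-sym (cU-mod-n d)) (≅-trans (≅-from-sum (∣-trans (divides sₖ (trans s≡ (cong (sₖ *_) e))) s∣))
      (≅-trans (≅-trans (≅-reflexive (sym (ℤ.+-identityˡ (- (w * A))))) (≅-- (≅-refl {0ℤ}) (wA-mod-n d)))
        (≅-reflexive (trans (lem ⟪ δ ⟫ k (+ 2 * m ^ X * (+ 2 * m ^ X))) (cong (λ x → x * k * (+ 2 * m ^ X * (+ 2 * m ^ X))) (neg δ)))))))
    where
    d = subst (_∣ n) e sₙ∣n
    lem : ∀ x k z → 0ℤ - x * k * z ≡ - x * k * z
    lem = solve-∀
    neg : ∀ δ → - ⟪ δ ⟫ ≡ ⟪ opposite δ ⟫
    neg Sign.+ = refl
    neg Sign.- = refl

  -- Modulo 4 the chain is k = τsₖ ≡ sₙsₖ = s ≡ P ≡ k - 2.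
  impossible : ⊥
  impossible = from-no (+ 4 ∣? + 2) (subst (+ 4 ∣_) (lem k) (diff k≅))
    where
    τ≅sₙ : τ ≅ sₙ [ + 4 ]
    τ≅sₙ = reciprocity-mod-4 δ odd-k odd-n odd-τ odd-sₖ odd-tₙ odd-sₙ k⊥n k≡ n≡
      (≅-trans (≅-weaken {N = + 16} (divides (+ 4) refl) n≅9) (≅-by (+ 2) refl)) on-τ on-sₖ on-tₙ on-sₙ
    k≅ : k ≅ k - + 2 [ + 4 ]
    k≅ = ≅-trans (≅-reflexive k≡) (≅-trans (≅-* τ≅sₙ (≅-refl {sₖ})) (≅-trans (≅-reflexive (trans (ℤ.*-comm sₙ sₖ) (sym s≡))) (≅-trans s≅P (≅-by {b = k - + 2} (proj₁ (≅-expand L₁≅)) refl))))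
    lem : ∀ k → k - (k - + 2) ≡ + 2
    lem = solve-∀

-- Residues of n modulo 8 and assembly of the cases

data OddResidue (n : ℤ) : Set where
  ≅1 : n ≅ 1ℤ [ + 8 ] → OddResidue n
  ≅3 : n ≅ + 3 [ + 8 ] → OddResidue n
  ≅5 : n ≅ + 5 [ + 8 ] → OddResidue n
  ≅7 : n ≅ + 7 [ + 8 ] → OddResidue n

oddResidue : ∀ h → OddResidue (odd h)
oddResidue 0 = ≅1 (≅-reflexive (odd≡ 0))
oddResidue 1 = ≅3 (≅-reflexive (odd≡ 1))
oddResidue 2 = ≅5 (≅-reflexive (odd≡ 2))
oddResidue 3 = ≅7 (≅-reflexive (odd≡ 3))
oddResidue (suc (suc (suc (suc h)))) with oddResidue h
... | ≅1 e = ≅1 (≅-trans (odd-+4 h) e)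
... | ≅3 e = ≅3 (≅-trans (odd-+4 h) e)
... | ≅5 e = ≅5 (≅-trans (odd-+4 h) e)
... | ≅7 e = ≅7 (≅-trans (odd-+4 h) e)

≅1-lift : ∀ {n} → n ≅ 1ℤ [ + 8 ] → n ≅ 1ℤ [ + 16 ] ⊎ n ≅ + 9 [ + 16 ]
≅1-lift {n} e with ≅-expand e
... | q , n≡ with ℤ-parity q
... | p , inj₁ q≡ = inj₁ (≅-by {b = 1ℤ} p (trans n≡ (trans (cong (λ q → 1ℤ + q * + 8) q≡) (lem p))))
  where
  lem : ∀ p → 1ℤ + p * + 2 * + 8 ≡ 1ℤ + p * + 16
  lem = solve-∀
... | p , inj₂ q≡ = inj₂ (≅-by {b = + 9} p (trans n≡ (trans (cong (λ q → 1ℤ + q * + 8) q≡) (lem p))))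
  where
  lem : ∀ p → 1ℤ + (1ℤ + p * + 2) * + 8 ≡ + 9 + p * + 16
  lem = solve-∀

Even : ℕ → Set
Even x = ∃[ h ] x ≡ 2 ℕ.* h

module Main (m n k : ℤ) (m≡ : m ≡ + 4 * k) (odd-k : Odd k) (odd-n : Odd n) (m⊥n : Cop m n)
  (a b c : ℤ) (a≡ : a ≡ m * m - n * n) (b≡ : b ≡ + 2 * m * n) (c≡ : c ≡ m * m + n * n) (n<m : n < m) where

  open Triple m n k m≡ odd-k odd-n m⊥n a b c a≡ b≡ c≡

  m-n m+n : ℤ
  m-n = m - n
  m+n = m + n

  pos-m-n : Pos m-n
  pos-m-n = subst (_< m - n) (ℤ.+-inverseʳ n) (ℤ.+-monoˡ-< (- n) n<m)

  a≡* : a ≡ (m - n) * (m + n)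
  a≡* = trans a≡ (lem m n)
    where
    lem : ∀ m n → m * m - n * n ≡ (m - n) * (m + n)
    lem = solve-∀

  pos-a : Pos a
  pos-a = subst Pos (sym a≡*) (pos-* pos-m-n (pos-+ pos-m pos-n))

  m≅4 : m ≅ + 4 [ + 8 ]
  m≅4 = ≅-by {b = + 4} q (trans m≡ (trans (cong (+ 4 *_) (proj₂ (≅-expand (odd⇒≅1 odd-k)))) (lem q)))
    where
    q = proj₁ (≅-expand (odd⇒≅1 odd-k))
    lem : ∀ q → + 4 * (1ℤ + q * + 2) ≡ + 4 + q * + 8
    lem = solve-∀

  m²≅16 : m * m ≅ + 16 [ + 32 ]
  m²≅16 = ≅-by {b = + 16} (q + + 2 * (q * q) + q) (trans (cong₂ _*_ m≡ m≡) (trans (cong (λ k → + 4 * k * (+ 4 * k)) (proj₂ (≅-expand (odd⇒≅1 odd-k)))) (lem q)))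
    where
    q = proj₁ (≅-expand (odd⇒≅1 odd-k))
    lem : ∀ q → + 4 * (1ℤ + q * + 2) * (+ 4 * (1ℤ + q * + 2)) ≡ + 16 + (q + + 2 * (q * q) + q) * + 32
    lem = solve-∀

  b^≅0 : ∀ y → b ^ suc (suc y) ≅ 0ℤ [ + 32 ]
  b^≅0 y = ∣⇒≅0 (divides (+ 2 * (k * n * (k * n)) * b ^ y) (trans (cong₂ (λ x z → x * (z * b ^ y)) b≡8kn b≡8kn) (lem (k * n) (b ^ y))))
    where
    lem : ∀ K z → + 8 * K * (+ 8 * K * z) ≡ + 2 * (K * K) * z * + 32
    lem = solve-∀

  odd-m-n : Odd m-n
  odd-m-n = pos⇒odd pos-m-n (cop-sym (cop-∣ (divides m+n (trans a≡* (ℤ.*-comm m-n m+n))) (cop-sym 2⊥a)))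

  odd-m+n : Odd m+n
  odd-m+n = pos⇒odd (pos-+ pos-m pos-n) (cop-sym (cop-∣ (divides m-n a≡*) (cop-sym 2⊥a)))

  n⊥m-n : Cop n m-n
  n⊥m-n = cop-sym (cop-≅ (≅-by -1ℤ (lem m n)) m⊥n)
    where
    lem : ∀ m n → m - n ≡ m + -1ℤ * n
    lem = solve-∀

  n⊥m+n : Cop n m+n
  n⊥m+n = cop-sym (cop-≅ (≅-by 1ℤ (lem m n)) m⊥n)
    where
    lem : ∀ m n → m + n ≡ m + 1ℤ * n
    lem = solve-∀

  -- The common residue of b and c modulo m - n, and of -b and c modulo m + n; both moduli divide a,
  -- so the equation there compares powers of ±d.
  d : ℤ
  d = + 2 * (n * n)

  b≅d : b ≅ d [ m-n ]
  b≅d = ≅-by (+ 2 * n) (trans b≡ (lem m n))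
    where
    lem : ∀ m n → + 2 * m * n ≡ + 2 * (n * n) + + 2 * n * (m - n)
    lem = solve-∀

  c≅d : c ≅ d [ m-n ]
  c≅d = ≅-by (m + n) (trans c≡ (lem m n))
    where
    lem : ∀ m n → m * m + n * n ≡ + 2 * (n * n) + (m + n) * (m - n)
    lem = solve-∀

  b≅-d : b ≅ - d [ m+n ]
  b≅-d = ≅-by (+ 2 * n) (trans b≡ (lem m n))
    where
    lem : ∀ m n → + 2 * m * n ≡ - (+ 2 * (n * n)) + + 2 * n * (m + n)
    lem = solve-∀

  c≅d′ : c ≅ d [ m+n ]
  c≅d′ = ≅-by (m - n) (trans c≡ (lem m n))
    where
    lem : ∀ m n → m * m + n * n ≡ + 2 * (n * n) + (m - n) * (m + n)
    lem = solve-∀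

  -- d is twice a square, so equal powers with exponents of different parity make 2 a square.
  equal-powers⇒2-square : ∀ i j → d ^ (2 ℕ.* i) ≅ d ^ suc (2 ℕ.* j) [ m-n ] → m-n ≅ 1ℤ [ + 8 ] ⊎ m-n ≅ -1ℤ [ + 8 ]
  equal-powers⇒2-square i j e = two-is-square {u = d ^ i} {n * d ^ j} odd-m-n
    (cop-* n⊥m-n (cop-^ j (cop-* (cop-2 odd-m-n) (cop-* n⊥m-n n⊥m-n))))
    (≅-trans (≅-reflexive (sym (^-double d i))) (≅-trans e (≅-reflexive (trans (^-suc-double d j) (lem n (d ^ j))))))
    where
    lem : ∀ n p → + 2 * (n * n) * (p * p) ≡ + 2 * (n * p * (n * p))
    lem = solve-∀

  -- Dividing by the unit d leaves d^(2i) + d^(2j) ≡ 0, so -1 is a square modulo m + n.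
  opposite-odd-powers : ∀ i j → (- d) ^ suc (2 ℕ.* j) ≅ d ^ suc (2 ℕ.* i) [ m+n ] → m+n ≅ 1ℤ [ + 4 ]
  opposite-odd-powers i j e = sum-of-squares {u = d ^ i} {d ^ j} odd-m+n (cop-^ j d⊥) (cop-∣-* (cop-sym d⊥)
    (∣-mul -1ℤ (diff (≅-trans (≅-reflexive (sym (neg-^ d j))) e)) (lem₁ j)))
    where
    d⊥ : Cop d m+n
    d⊥ = cop-* (cop-2 odd-m+n) (cop-* n⊥m+n n⊥m+n)
    lem : ∀ d p q → d * (p * p + q * q) ≡ -1ℤ * (- (d * (q * q)) - d * (p * p))
    lem = solve-∀
    lem₁ : ∀ j → d * (d ^ i * d ^ i + d ^ j * d ^ j) ≡ -1ℤ * (- (d ^ suc (2 ℕ.* j)) - d ^ suc (2 ℕ.* i))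
    lem₁ j = trans (lem d (d ^ i) (d ^ j)) (cong₂ (λ p q → -1ℤ * (- p - q)) (sym (^-suc-double d j)) (sym (^-suc-double d i)))

  module Equation (X y z : ℕ) (0<X : 0 ℕ.< X) (0<z : 0 ℕ.< z) (eq : a ^ (2 ℕ.* X) + b ^ suc (suc y) ≡ c ^ z) where

    positive-half : ∀ {w h} → 0 ℕ.< w → w ≡ 2 ℕ.* h → 0 ℕ.< h
    positive-half {h = zero}  p refl = p
    positive-half {h = suc h} p _    = s≤s z≤n

    b≅c : ∀ {N} → N ∣ a → b ^ suc (suc y) ≅ c ^ z [ N ]
    b≅c N∣a = ≅-trans (≅-trans (≅-reflexive (sym (ℤ.+-identityˡ _))) (≅-+ (≅-sym (∣⇒≅0 (a∣ X 0<X))) ≅-refl)) (≅-reflexive eq)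
      where
      a∣ : ∀ X → 0 ℕ.< X → _ ∣ a ^ (2 ℕ.* X)
      a∣ (suc X) _ = ∣-trans N∣a (∣-*ˡ _)

    -- 8 divides b and its exponent is at least 2, so only the even power of a survives.
    c^≅1 : ∀ {N r} → N ∣ + 32 → a ≅ r [ N ] → r * r ≅ 1ℤ [ N ] → c ^ z ≅ 1ℤ [ N ]
    c^≅1 N∣32 e s = ≅-trans (≅-reflexive (sym eq)) (≅-+ (^-even-≅ e s X) (≅-weaken N∣32 (b^≅0 y)))

    conclusion = Even (suc (suc y)) × Even z

    ±3-case : n * n ≅ + 9 [ + 16 ] → conclusion
    ±3-case n²≅9 = by-parity (ℕ-parity (suc (suc y))) (ℕ-parity z)
      where
      open EvenExponents pos-a n²≅9
      by-parity : Parity (suc (suc y)) → Parity z → conclusion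
      by-parity _ (i , inj₂ ez) = contradiction
        (≅-trans (≅-sym (subst (λ z → c ^ z ≅ + 9 [ + 16 ]) (sym ez) (^-odd-≅ c≅9 9² i))) (c^≅1 (divides (+ 2) refl) a≅7 7²))
        (≇-by (from-no (+ 16 ∣? + 9 - 1ℤ)))
      by-parity (j , inj₁ ey) (i , inj₁ ez) = (j , ey) , (i , ez)
      by-parity (zero , inj₂ ()) _
      by-parity (suc j , inj₂ ey) (i , inj₁ ez) = ⊥-elim (odd-y-impossible X i (suc j) 0<X (positive-half 0<z ez) (s≤s z≤n)
        (subst₂ (λ y z → a ^ (2 ℕ.* X) + b ^ y ≡ c ^ z) ey ez eq))

    same-parity : ¬ (m-n ≅ 1ℤ [ + 8 ] ⊎ m-n ≅ -1ℤ [ + 8 ]) →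
      (∀ i j → suc (suc y) ≡ suc (2 ℕ.* suc j) → z ≡ suc (2 ℕ.* i) → ⊥) → conclusion
    same-parity no-2-square no-odd = by-parity (ℕ-parity (suc (suc y))) (ℕ-parity z)
      where
      d^≅ : d ^ suc (suc y) ≅ d ^ z [ m-n ]
      d^≅ = ≅-trans (≅-sym (≅-^ b≅d (suc (suc y)))) (≅-trans (b≅c (divides m+n (trans a≡* (ℤ.*-comm m-n m+n)))) (≅-^ c≅d z))
      by-parity : Parity (suc (suc y)) → Parity z → conclusion
      by-parity (j , inj₁ ey) (i , inj₁ ez) = (j , ey) , (i , ez)
      by-parity (j , inj₁ ey) (i , inj₂ ez) = contradiction (equal-powers⇒2-square j i (subst₂ (λ y z → d ^ y ≅ d ^ z [ m-n ]) ey ez d^≅)) no-2-square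
      by-parity (j , inj₂ ey) (i , inj₁ ez) = contradiction (equal-powers⇒2-square i j (≅-sym (subst₂ (λ y z → d ^ y ≅ d ^ z [ m-n ]) ey ez d^≅))) no-2-square
      by-parity (zero , inj₂ ()) (i , inj₂ ez)
      by-parity (suc j , inj₂ ey) (i , inj₂ ez) = ⊥-elim (no-odd i j ey ez)

    ≇±1 : ∀ {r} → m-n ≅ r [ + 8 ] → ¬ (+ 8 ∣ r - 1ℤ) → ¬ (+ 8 ∣ r - -1ℤ) → ¬ (m-n ≅ 1ℤ [ + 8 ] ⊎ m-n ≅ -1ℤ [ + 8 ])
    ≇±1 e n₁ n₂ = [ (λ f → n₁ (diff (≅-trans (≅-sym e) f))) , (λ f → n₂ (diff (≅-trans (≅-sym e) f))) ]′

    7-case : n ≅ + 7 [ + 8 ] → conclusion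
    7-case n≅7 = same-parity (≇±1 (≅-- m≅4 n≅7) (from-no (+ 8 ∣? + 4 - + 7 - 1ℤ)) (from-no (+ 8 ∣? + 4 - + 7 - -1ℤ)))
      λ i j ey ez → ≇-by (from-no (+ 4 ∣? + 4 + + 7 - 1ℤ)) (≅-trans (≅-sym (≅-weaken (divides (+ 2) refl) (≅-+ m≅4 n≅7)))
        (opposite-odd-powers i (suc j) (subst₂ (λ y z → (- d) ^ y ≅ d ^ z [ m+n ]) ey ez
          (≅-trans (≅-sym (≅-^ b≅-d (suc (suc y)))) (≅-trans (b≅c (divides m-n a≡*)) (≅-^ c≅d′ z))))))

    1-case : n ≅ 1ℤ [ + 8 ] → conclusion
    1-case n≅1 = same-parity (≇±1 (≅-- m≅4 n≅1) (from-no (+ 8 ∣? + 4 - 1ℤ - 1ℤ)) (from-no (+ 8 ∣? + 4 - 1ℤ - -1ℤ)))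
      λ i j ey ez → [ mod-32 i ez , (λ n≅9 → OddExponents.impossible m n k m≡ odd-k odd-n m⊥n a b c a≡ b≡ c≡ n≅9 X i j
        (subst₂ (λ y z → a ^ (2 ℕ.* X) + b ^ y ≡ c ^ z) ey ez eq)) ]′ (≅1-lift n≅1)
      where
      -- Here m² ≡ 16 and n² ≡ 1 (mod 32), so c ≡ 17 and a ≡ 15, both with square 1. Odd z gives c^z
      -- ≡ 17, but the left side is ≡ 1.
      mod-32 : ∀ i → z ≡ suc (2 ℕ.* i) → n ≅ 1ℤ [ + 16 ] → ⊥
      mod-32 i ez n≅1 = ≇-by (from-no (+ 32 ∣? + 17 - 1ℤ)) (≅-trans
        (≅-sym (subst (λ z → c ^ z ≅ + 17 [ + 32 ]) (sym ez) (^-odd-≅ (≅-trans (≅-reflexive c≡) (≅-+ m²≅16 (square-mod-32 n≅1))) (≅-by (+ 9) refl) i)))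
        (c^≅1 ∣-refl (≅-trans (≅-reflexive a≡) (≅-- m²≅16 (square-mod-32 n≅1))) (≅-by (+ 7) refl)))

    by-residue : ∀ {n′} → n ≡ n′ → OddResidue n′ → conclusion
    by-residue refl (≅1 e) = 1-case e
    by-residue refl (≅3 e) = ±3-case (square-mod-16 e)
    by-residue refl (≅5 e) = ±3-case (≅-trans (square-mod-16 e) (≅-by 1ℤ refl))
    by-residue refl (≅7 e) = 7-case e

    even : conclusion
    even = by-residue (proj₂ odd-n) (oddResidue (proj₁ odd-n))

  x-even : ∀ x y z → a ^ x + b ^ suc (suc y) ≡ c ^ z → Even x
  x-even x y z eq with ℕ-parity x
  ... | X , inj₁ e = X , e
  ... | X , inj₂ refl = contradiction
    (≅-trans (≅-sym (≅-+ (^-odd-≅ a≅-1mod8 ≅-refl X) (≅-weaken (divides (+ 4) refl) (b^≅0 y)))) (≅-trans (≅-reflexive eq) (≅1-^ c≅1mod8 z)))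
    (≇-by (from-no (+ 8 ∣? -1ℤ + 0ℤ - 1ℤ)))

  all-even : ∀ x y z → 0 ℕ.< x → 0 ℕ.< z → a ^ x + b ^ suc (suc y) ≡ c ^ z → Even x × Even (suc (suc y)) × Even z
  all-even x y z 0<x 0<z eq with x-even x y z eq
  ... | zero  , refl = contradiction 0<x λ ()
  ... | suc X , refl = (suc X , refl) , Equation.even (suc X) y z (s≤s z≤n) 0<z eq

-- Transfer from natural numbers to integers

+-^ : ∀ u j → + (u ℕ.^ j) ≡ (+ u) ^ j
+-^ u zero    = refl
+-^ u (suc j) = trans (ℤ.pos-* u (u ℕ.^ j)) (cong (+ u *_) (+-^ u j))

+-square : ∀ u → + (u ℕ.^ 2) ≡ + u * + u
+-square u = trans (+-^ u 2) (cong (+ u *_) (ℤ.*-identityʳ (+ u)))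

even⇒%2≡0 : ∀ {x} → Even x → x ℕ.% 2 ≡ 0
even⇒%2≡0 (h , refl) = trans (cong (ℕ._% 2) (ℕ.*-comm 2 h)) (ℕ.m*n%n≡0 h 2)

mainTheorem4 : (m n : ℕ) → 0 ℕ.< m → 0 ℕ.< n → m ℕ.> n → ℕ.Coprime m n →
    m ℕ.% 2 ≢ n ℕ.% 2 → 4 ℕ.∣ m → 8 ℕ.∤ m →
    (x y z : ℕ) → 0 ℕ.< x → 0 ℕ.< y → 0 ℕ.< z →
    (m ℕ.^ 2 ℕ.∸ n ℕ.^ 2) ℕ.^ x ℕ.+ (2 ℕ.* m ℕ.* n) ℕ.^ y ≡ (m ℕ.^ 2 ℕ.+ n ℕ.^ 2) ℕ.^ z →
    y ≡ 1 ⊎ (x ℕ.% 2 ≡ 0 × y ℕ.% 2 ≡ 0 × z ℕ.% 2 ≡ 0)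
mainTheorem4 m n _ 0<n n<m m⊥n m%2≢n%2 (ℕ.divides k m≡) 8∤m x (suc zero) z _ _ _ _ = inj₁ refl
mainTheorem4 m n _ 0<n n<m m⊥n m%2≢n%2 (ℕ.divides k m≡) 8∤m x (suc (suc y)) z 0<x _ 0<z eq =
  inj₂ (conclude (Main.all-even (+ m) (+ n) (+ k) m≡4k odd-k odd-n (coprime⇒cop m⊥n)
    (+ a) (+ b) (+ c) a≡ b≡ c≡ (+<+ n<m) x y z 0<x 0<z eqℤ))
  where
  a = m ℕ.^ 2 ℕ.∸ n ℕ.^ 2
  b = 2 ℕ.* m ℕ.* n
  c = m ℕ.^ 2 ℕ.+ n ℕ.^ 2
  conclude : Even x × Even (suc (suc y)) × Even z → x ℕ.% 2 ≡ 0 × suc (suc y) ℕ.% 2 ≡ 0 × z ℕ.% 2 ≡ 0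
  conclude (ex , ey , ez) = even⇒%2≡0 ex , even⇒%2≡0 ey , even⇒%2≡0 ez
  m≡4k : + m ≡ + 4 * + k
  m≡4k = trans (cong +_ (trans m≡ (ℕ.*-comm k 4))) (ℤ.pos-* 4 k)
  odd-k : Odd (+ k)
  odd-k with ℕ-parity k
  ... | h , inj₁ e = contradiction (ℕ.divides h (trans m≡ (trans (cong (ℕ._* 4) (trans e (ℕ.*-comm 2 h))) (ℕ.*-assoc h 2 4)))) 8∤m
  ... | h , inj₂ e = h , trans (cong +_ e) (sym (odd≡ h))
  m%2≡0 : m ℕ.% 2 ≡ 0
  m%2≡0 = even⇒%2≡0 (k ℕ.* 2 , trans m≡ (trans (sym (ℕ.*-assoc k 2 2)) (ℕ.*-comm (k ℕ.* 2) 2)))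
  odd-n : Odd (+ n)
  odd-n with ℕ-parity n
  ... | h , inj₁ e = contradiction (trans m%2≡0 (sym (even⇒%2≡0 (h , e)))) m%2≢n%2
  ... | h , inj₂ e = h , trans (cong +_ e) (sym (odd≡ h))
  a≡ : + a ≡ + m * + m - + n * + n
  -- The truncated subtraction is exact because n < m.
  a≡ = trans (pos-∸ (ℕ.^-monoˡ-≤ 2 (ℕ.<⇒≤ n<m))) (cong₂ _-_ (+-square m) (+-square n))
  b≡ : + b ≡ + 2 * + m * + n
  b≡ = trans (ℤ.pos-* (2 ℕ.* m) n) (cong (_* + n) (ℤ.pos-* 2 m))
  c≡ : + c ≡ + m * + m + + n * + n
  c≡ = cong₂ _+_ (+-square m) (+-square n)
  eqℤ : (+ a) ^ x + (+ b) ^ suc (suc y) ≡ (+ c) ^ z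
  eqℤ = trans (cong₂ _+_ (sym (+-^ a x)) (sym (+-^ b (suc (suc y))))) (trans (cong +_ eq) (+-^ c z))
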